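{- Let $\alpha,\beta>0$ be fixed constants, let $n$ be sufficiently large, and let $f(n)$ be any function satisfying $f(n)\to\infty$ as $n\to\infty$. Let $a,b$ (integers) and $p\in(0,1]$ be functions of $n$ which satisfy $\ln^2 n\le a\le b\le n$, $ap\le\alpha\cdot\ln n$ and $bp>n^{\beta}$. Then, for $G\sim G(A,B,p)$, where $|A|=a$ and $|B|=b$, $$\mathbb{P}\left(\exists\text{ a dominating set } D\subset B \text{ of } A \text{ with } |D|\le\frac{f(n)}{p}\ \Big|\ \forall v\in A,\ N(v)\ne\emptyset\right)\ \ge\ 1-\exp\left[-b^{1-o(1)}\right],$$ where $o(1)$ denotes a quantity tending to $0$ as $n\to\infty$.
   Context: For disjoint sets $A,B$ and $p\in[0,1]$, $G(A,B,p)$ is the random bipartite graph with parts $A$ and $B$ in which each edge with one endpoint in $A$ and the other in $B$ is included independently with probability $p$. $N(v)$ denotes the neighbourhood of the vertex $v$. A set $D\subseteq B$ is a dominating set of $A$ if every vertex of $A$ has at least one neighbour in $D$. -}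

module Defs where

open import Level using (0ℓ)
open import Algebra.Bundles using (CommutativeRing)
open import Axiom.ExcludedMiddle using (ExcludedMiddle)
open import Data.Bool.Base using (if_then_else_)
open import Data.Fin.Base using (Fin; toℕ)
open import Data.Fin.Subset using (Subset; inside; outside; Nonempty; _∈_)
open import Data.List.Base using (List; []; _∷_; cartesianProductWith; foldr; map)
open import Data.Nat.Base as ℕ using (ℕ; zero; suc; _!)
open import Data.Product.Base using (∃-syntax; _×_; _,_)
open import Data.Vec.Base as Vec using (Vec; []; _∷_; lookup)
open import Relation.Binary.Core using (Rel)
open import Relation.Binary.Structures using (IsTotalOrder)
open import Relation.Nullary.Decidable.Core using (yes; no; does)
open import Relation.Nullary.Negation.Core using (¬_)
open import Relation.Unary using (Pred; _∩_)

Eventually : Pred ℕ 0ℓ → Set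
Eventually P = ∃[ N ] (∀ n → N ℕ.≤ n → P n)

-- The real numbers are characterised, up to unique isomorphism, as the
-- Dedekind-complete ordered field.
record CompleteOrderedField : Set₁ where
  infix 4 _≤_
  field
    commutativeRing : CommutativeRing 0ℓ 0ℓ

  open CommutativeRing commutativeRing public

  field
    0≉1          : ¬ (0# ≈ 1#)
    invertible   : ∀ x → ¬ (x ≈ 0#) → ∃[ y ] (x * y ≈ 1#)
    _≤_          : Rel Carrier 0ℓ
    isTotalOrder : IsTotalOrder _≈_ _≤_
    +-mono-≤     : ∀ {x y} z → x ≤ y → x + z ≤ y + z
    *-nonneg     : ∀ {x y} → 0# ≤ x → 0# ≤ y → 0# ≤ x * y

  IsUpperBound : Pred Carrier 0ℓ → Carrier → Set
  IsUpperBound P u = ∀ x → P x → x ≤ u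

  field
    complete : (P : Pred Carrier 0ℓ) →
               ∃[ x ] P x → ∃[ u ] IsUpperBound P u →
               ∃[ s ] (IsUpperBound P s × (∀ u → IsUpperBound P u → s ≤ u))

-- The parts are A = Fin a and B = Fin b, disjoint by being different
-- types of vertices. Row v of the edge set is the neighbourhood of v ∈ A.
BipartiteGraph : ℕ → ℕ → Set
BipartiteGraph a b = Vec (Subset b) a

module _ {a b : ℕ} where

  N : BipartiteGraph a b → Fin a → Subset b
  N G v = lookup G v

  NoIsolatedVertex : Pred (BipartiteGraph a b) 0ℓ
  NoIsolatedVertex G = ∀ v → Nonempty (N G v)

  Dominating : BipartiteGraph a b → Pred (Subset b) 0ℓ
  Dominating G D = ∀ v → ∃[ w ] (w ∈ N G v × w ∈ D)

allVecs : {A : Set} → List A → ∀ n → List (Vec A n)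
allVecs xs zero    = [] ∷ []
allVecs xs (suc n) = cartesianProductWith _∷_ xs (allVecs xs n)

allGraphs : ∀ a b → List (BipartiteGraph a b)
allGraphs a b = allVecs (allVecs (inside ∷ outside ∷ []) b) a

-- Excluded middle is the ambient logic here: it decides events such as
-- ∣ D ∣ ≤ f n / p n, and it makes limits, inverses and logarithms into total
-- functions with the value 0 where undefined.
module RealAnalysis (em : ExcludedMiddle 0ℓ) (R : CompleteOrderedField) where

  open CompleteOrderedField R public
    using (_≈_; _≤_; _+_; _*_; -_; _-_; 0#; 1#; semiring)
    renaming (Carrier to ℝ)
  open CompleteOrderedField R using (*-commutativeMonoid; +-commutativeMonoid)
  open import Relation.Binary.Construct.NonStrictToStrict _≈_ _≤_ public
    using (_<_)
  open import Algebra.Properties.Semiring.Exp semiring public using (_^_)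
  open import Algebra.Properties.Semiring.Mult semiring
    using () renaming (_×_ to _·_)
  open import Algebra.Properties.CommutativeMonoid.Sum +-commutativeMonoid
    using (sum-syntax)
  open import Algebra.Properties.CommutativeMonoid.Sum *-commutativeMonoid
    using () renaming (sum to product)

  infixl 7 _/_
  infixr 8 _^ʳ_
  infix 4 _⟶_

  -- The element satisfying P, for a P satisfied by at most one element up
  -- to _≈_; 0 if no element satisfies P.
  the : Pred ℝ 0ℓ → ℝ
  the P with em {∃[ x ] P x}
  ... | yes (x , _) = x
  ... | no  _       = 0#

  _/_ : ℝ → ℝ → ℝ
  x / y = x * the (λ z → y * z ≈ 1#)

  fromℕ : ℕ → ℝ
  fromℕ n = n · 1#

  _⟶_ : (ℕ → ℝ) → ℝ → Set
  s ⟶ l = ∀ ε → 0# < ε →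
          Eventually (λ n → (l - ε < s n) × (s n < l + ε))

  _⟶∞ : (ℕ → ℝ) → Set
  s ⟶∞ = ∀ M → Eventually (λ n → M ≤ s n)

  lim : (ℕ → ℝ) → ℝ
  lim s = the (s ⟶_)

  exp : ℝ → ℝ
  exp x = lim (λ n → ∑[ k < n ] (x ^ toℕ k / fromℕ (toℕ k !)))

  ln : ℝ → ℝ
  ln x = the (λ y → exp y ≈ x)

  -- Real powers, for a positive base.
  _^ʳ_ : ℝ → ℝ → ℝ
  x ^ʳ y = exp (y * ln x)

  -- G(A, B, p): the product measure on the finitely many bipartite graphs.
  module RandomBipartiteGraph (a b : ℕ) (p : ℝ) where

    weight : BipartiteGraph a b → ℝ
    weight G = product λ (v : Fin a) → product λ (w : Fin b) →
      if lookup (N G v) w then p else 1# - p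

    indicator : Pred (BipartiteGraph a b) 0ℓ → BipartiteGraph a b → ℝ
    indicator E G = if does (em {E G}) then 1# else 0#

    ℙ[_] : Pred (BipartiteGraph a b) 0ℓ → ℝ
    ℙ[ E ] = foldr _+_ 0# (map (λ G → weight G * indicator E G) (allGraphs a b))

    ℙ[_∣_] : Pred (BipartiteGraph a b) 0ℓ → Pred (BipartiteGraph a b) 0ℓ → ℝ
    ℙ[ E ∣ F ] = ℙ[ E ∩ F ] / ℙ[ F ]

{-# OPTIONS --safe #-}
-- Write L = ln n, η = 36α/f, κ = ηLp. Suppose that every nonempty U ⊆ A contains at
-- least √(κ∣U∣) neighbours of some w ∈ B. Picking such a w greedily lowers √∣U∣ by a
-- constant multiple of √κ, so A is dominated by ⌊f/p⌋ vertices as soon as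
-- 9a ≤ κ⌊f/p⌋². For κ∣U∣ ≤ 1 the supposition only says that some vertex of U is not
-- isolated. For κ∣U∣ > 1 put s = ⌈√(κ∣U∣)⌉ ≥ 2 and split U into s groups of size
-- m = ⌊∣U∣/s⌋: a given w meets all of them with probability at least
-- (1 + 1/(pm))⁻ˢ ≥ exp (- s/(pm)) ≥ exp (- 8ηL) = q, because s² ≤ 4κ∣U∣. The
-- neighbourhoods of the w ∈ B are independent, so a union bound over the U ⊆ A bounds
-- the failure probability by 2ᵃ exp (- bq), where q = n^(- o(1)) and a = o(bq).
-- Conditioning on no isolated vertex, an event of probability at least 1/2, costs a
-- factor of 2.

module Submission where

open import Defs
open import Algebra.Bundles using (RawRing)
import Algebra.Solver.Ring
open import Algebra.Solver.Ring.AlmostCommutativeRing using (fromCommutativeRing; _-Raw-AlmostCommutative⟶_)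
open import Axiom.ExcludedMiddle using (ExcludedMiddle)
open import Data.Bool.Base using (true; false; Bool; if_then_else_)
open import Data.Empty using (⊥-elim)
open import Data.Fin.Base as Fin using (Fin; toℕ; zero; suc)
import Data.Fin.Properties as Fin
open import Data.Fin.Subset using (Subset; inside; outside; Nonempty; _∈_; ∣_∣; ⊥; ⁅_⁆; _∩_; _∪_; _─_; ⊤)
open import Data.Fin.Subset.Properties using (nonempty?; _∈?_; x∈p⇒∣p-x∣<∣p∣; x∈⁅x⁆; x∈p∪q⁺; ∣⁅x⁆∣≡1; ∣⊥∣≡0; x∈p∧x∉q⇒x∈p─q; ∣p∩q∣≤∣q∣; ∈⊤; ∣⊤∣≡n; x∈p∩q⁺)
open import Data.Integer.Base as ℤ using (ℤ; +_; -[1+_])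
import Data.Integer.Properties as ℤ
open import Data.List.Base using (List; []; _∷_; _++_; cartesianProductWith; foldr; map)
open import Data.Maybe.Base using (Maybe; just; nothing)
open import Data.Nat.Base as ℕ using (ℕ; zero; suc; z≤n; s≤s; _!)
import Data.Nat.DivMod as ℕ
import Data.Nat.Properties as ℕ
open import Data.Product.Base using (∃-syntax; _×_; _,_; proj₁; proj₂)
open import Data.Sum.Base using (inj₁; inj₂; [_,_]′)
open import Data.Vec.Base as Vec using (Vec; []; _∷_; lookup; zipWith; here; there)
import Data.Vec.Properties as Vec
open import Level using (0ℓ)
open import Relation.Binary.Bundles using (Poset)
open import Relation.Binary.PropositionalEquality.Core as ≡ using (_≡_)
open import Relation.Nullary.Decidable.Core using (yes; no; does)
open import Relation.Nullary.Negation.Core using (¬_; contradiction)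
open import Relation.Unary as Unary using (Pred)

-- The expected number of neighbours of w in U is p∣U∣. A greedy choice with only this guarantee
-- takes about ln(ap)/p steps to get from a down to 1/p vertices, which is too many when f grows
-- slowly. The bound √(κ∣U∣) exceeds p∣U∣ as soon as p∣U∣ < ηL, and with it the number of steps is
-- of order √(a/κ) = √(ap/(ηL))/p ≤ √(α/η)/p, with no logarithm left. This leaves η between two
-- demands: η → 0, so that q = n^(- 8η) is n^(- o(1)), and ηf² ≥ 36α, so that ⌊f/p⌋ steps are
-- enough. The choice 36α/f meets both once f ≥ 1. The sets U met by the greedy choice depend on the
-- graph, which is why the supposition is made for all U at once. The hypothesis ln² n ≤ a gives p
-- ln n ≤ α, hence κ ≤ ηα is small; this forces s ≤ ∣U∣, so the groups are not empty.

-- Arithmetic of a complete ordered field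

module OrderedField (em : ExcludedMiddle 0ℓ) (R : CompleteOrderedField) where
  open RealAnalysis em R
  open CompleteOrderedField R public
    using (refl; sym; trans; reflexive; commutativeRing; ring; +-abelianGroup;
           +-cong; +-congˡ; +-congʳ; *-cong; *-congˡ; *-congʳ; -‿cong;
           +-identityˡ; +-identityʳ; *-identityˡ; *-identityʳ; +-comm; *-comm; +-assoc; *-assoc;
           zeroˡ; zeroʳ; distribˡ; distribʳ; -‿inverseʳ;
           0≉1; invertible; isTotalOrder; +-mono-≤; *-nonneg; complete; IsUpperBound)
  open import Relation.Binary.Structures using (IsTotalOrder)
  open IsTotalOrder isTotalOrder public
    using (isPartialOrder; antisym; total)
    renaming (reflexive to ≤-reflexive; trans to ≤-trans; refl to ≤-refl)
  import Relation.Binary.Construct.NonStrictToStrict _≈_ _≤_ as Strict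
  open import Algebra.Properties.Semiring.Mult semiring public
    using (×-homo-+; ×1-homo-*; ×-congˡ)
  open import Algebra.Properties.Semiring.Exp semiring public
    using (^-congˡ)
  open import Algebra.Properties.Ring ring public
    using (-‿distribˡ-*; -‿distribʳ-*; -0#≈0#; -‿involutive)
  open import Algebra.Properties.AbelianGroup +-abelianGroup using (⁻¹-∙-comm)

  private
    poset : Poset 0ℓ 0ℓ 0ℓ
    poset = record { isPartialOrder = isPartialOrder }
  open import Relation.Binary.Reasoning.PartialOrder poset public

  private
    signed : ℤ → ℝ
    signed (+ n)    = fromℕ n
    signed -[1+ n ] = - fromℕ (suc n)

    +-cancelˡ-‿- : ∀ x y z → (x + y) + - (x + z) ≈ y + - z
    +-cancelˡ-‿- x y z = begin-equality
      (x + y) + - (x + z)     ≈⟨ +-cong (+-comm x y) (sym (⁻¹-∙-comm x z)) ⟩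
      (y + x) + (- x + - z)   ≈⟨ +-assoc y x _ ⟩
      y + (x + (- x + - z))   ≈⟨ +-congˡ (sym (+-assoc x (- x) (- z))) ⟩
      y + ((x + - x) + - z)   ≈⟨ +-congˡ (+-congʳ (-‿inverseʳ x)) ⟩
      y + (0# + - z)          ≈⟨ +-congˡ (+-identityˡ (- z)) ⟩
      y + - z                 ∎

    signed-⊖ : ∀ m n → signed (m ℤ.⊖ n) ≈ fromℕ m + - fromℕ n
    signed-⊖ m zero = sym (trans (+-congˡ -0#≈0#) (+-identityʳ _))
    signed-⊖ zero (suc n) = sym (+-identityˡ _)
    signed-⊖ (suc m) (suc n) rewrite ℤ.[1+m]⊖[1+n]≡m⊖n m n =
      trans (signed-⊖ m n) (sym (+-cancelˡ-‿- 1# (fromℕ m) (fromℕ n)))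

    signed-neg : ∀ i → signed (ℤ.- i) ≈ - signed i
    signed-neg (+ zero)  = sym -0#≈0#
    signed-neg (+ suc n) = refl
    signed-neg -[1+ n ]  = sym (-‿involutive _)

    signed-+ : ∀ i j → signed (i ℤ.+ j) ≈ signed i + signed j
    signed-+ (+ m) (+ n) = ×-homo-+ 1# m n
    signed-+ (+ m) -[1+ n ] = signed-⊖ m (suc n)
    signed-+ -[1+ m ] (+ n) = trans (signed-⊖ n (suc m)) (+-comm _ _)
    signed-+ -[1+ m ] -[1+ n ] = begin-equality
      - fromℕ (suc (suc (m ℕ.+ n)))        ≈⟨ -‿cong (×-congˡ (≡.cong suc (≡.sym (ℕ.+-suc m n)))) ⟩
      - fromℕ (suc m ℕ.+ suc n)            ≈⟨ -‿cong (×-homo-+ 1# (suc m) (suc n)) ⟩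
      - (fromℕ (suc m) + fromℕ (suc n))    ≈⟨ sym (⁻¹-∙-comm _ _) ⟩
      - fromℕ (suc m) + - fromℕ (suc n)    ∎

    signed-*⁺ : ∀ m j → signed (+ m ℤ.* j) ≈ fromℕ m * signed j
    signed-*⁺ m (+ n) rewrite ≡.sym (ℤ.pos-* m n) = ×1-homo-* m n
    signed-*⁺ m -[1+ n ] rewrite ≡.sym (ℤ.neg-distribʳ-* (+ m) (+ suc n)) | ≡.sym (ℤ.pos-* m (suc n)) =
      trans (signed-neg (+ (m ℕ.* suc n)))
        (trans (-‿cong (×1-homo-* m (suc n))) (-‿distribʳ-* _ _))

    signed-* : ∀ i j → signed (i ℤ.* j) ≈ signed i * signed j
    signed-* (+ m) j = signed-*⁺ m j
    signed-* -[1+ m ] j rewrite ≡.sym (ℤ.neg-distribˡ-* (+ suc m) j) =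
      trans (signed-neg (+ suc m ℤ.* j))
        (trans (-‿cong (signed-*⁺ (suc m) j)) (-‿distribˡ-* _ _))

    -- Keeps the solver's constant 1 syntactically equal to 1#.
    fromℤ : ℤ → ℝ
    fromℤ (+ 1) = 1#
    fromℤ i     = signed i

    fromℤ≈signed : ∀ i → fromℤ i ≈ signed i
    fromℤ≈signed (+ 0)             = refl
    fromℤ≈signed (+ 1)             = sym (+-identityʳ 1#)
    fromℤ≈signed (+ suc (suc n))   = refl
    fromℤ≈signed -[1+ n ]          = refl

    ℤ-rawRing : RawRing 0ℓ 0ℓ
    ℤ-rawRing = record
      { Carrier = ℤ ; _≈_ = _≡_ ; _+_ = ℤ._+_ ; _*_ = ℤ._*_ ; -_ = ℤ.-_ ; 0# = + 0 ; 1# = + 1 }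

    fromℤ-homo : ℤ-rawRing -Raw-AlmostCommutative⟶ fromCommutativeRing commutativeRing
    fromℤ-homo = record
      { ⟦_⟧    = fromℤ
      ; +-homo = λ i j → trans (fromℤ≈signed (i ℤ.+ j)) (trans (signed-+ i j)
                   (+-cong (sym (fromℤ≈signed i)) (sym (fromℤ≈signed j))))
      ; *-homo = λ i j → trans (fromℤ≈signed (i ℤ.* j)) (trans (signed-* i j)
                   (*-cong (sym (fromℤ≈signed i)) (sym (fromℤ≈signed j))))
      ; -‿homo = λ i → trans (fromℤ≈signed (ℤ.- i)) (trans (signed-neg i)
                   (-‿cong (sym (fromℤ≈signed i))))
      ; 0-homo = refl
      ; 1-homo = refl
      }

    fromℤ≟ : ∀ i j → Maybe (fromℤ i ≈ fromℤ j)
    fromℤ≟ i j with i ℤ.≟ j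
    ... | yes ≡.refl = just refl
    ... | no _       = nothing

  open Algebra.Solver.Ring ℤ-rawRing (fromCommutativeRing commutativeRing) fromℤ-homo fromℤ≟ public
    using (solve; _:=_; _:+_; _:*_; _:-_; :-_; con)

  ≤-by : ∀ {x y d} → 0# ≤ d → y ≈ x + d → x ≤ y
  ≤-by {x} {y} {d} 0≤d y≈x+d = begin
    x        ≈⟨ sym (+-identityˡ x) ⟩
    0# + x   ≤⟨ +-mono-≤ x 0≤d ⟩
    d + x    ≈⟨ trans (+-comm d x) (sym y≈x+d) ⟩
    y        ∎

  0≤y-x : ∀ {x y} → x ≤ y → 0# ≤ y - x
  0≤y-x {x} {y} x≤y = begin
    0#      ≈⟨ sym (-‿inverseʳ x) ⟩
    x - x   ≤⟨ +-mono-≤ (- x) x≤y ⟩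
    y - x   ∎

  +-mono : ∀ {x y u v} → x ≤ y → u ≤ v → x + u ≤ y + v
  +-mono {x} {y} {u} {v} x≤y u≤v = begin
    x + u   ≤⟨ +-mono-≤ u x≤y ⟩
    y + u   ≈⟨ +-comm y u ⟩
    u + y   ≤⟨ +-mono-≤ y u≤v ⟩
    v + y   ≈⟨ +-comm v y ⟩
    y + v   ∎

  +-nonneg : ∀ {x y} → 0# ≤ x → 0# ≤ y → 0# ≤ x + y
  +-nonneg 0≤x 0≤y = ≤-trans (≤-reflexive (sym (+-identityˡ 0#))) (+-mono 0≤x 0≤y)

  +-monoˡ : ∀ {x y} z → x ≤ y → z + x ≤ z + y
  +-monoˡ z = +-mono (≤-refl {z})

  x≤x+y : ∀ {x y} → 0# ≤ y → x ≤ x + y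
  x≤x+y 0≤y = ≤-by 0≤y refl

  neg-mono : ∀ {x y} → x ≤ y → - y ≤ - x
  neg-mono {x} {y} x≤y = ≤-by (0≤y-x x≤y) (solve 2 (λ x y → :- x := :- y :+ (y :- x)) refl x y)

  *-monoˡ : ∀ {z x y} → 0# ≤ z → x ≤ y → z * x ≤ z * y
  *-monoˡ {z} {x} {y} 0≤z x≤y = ≤-by (*-nonneg 0≤z (0≤y-x x≤y))
    (solve 3 (λ z x y → z :* y := z :* x :+ z :* (y :- x)) refl z x y)

  *-monoʳ : ∀ {z x y} → 0# ≤ z → x ≤ y → x * z ≤ y * z
  *-monoʳ {z} {x} {y} 0≤z x≤y = begin
    x * z  ≈⟨ *-comm x z ⟩
    z * x  ≤⟨ *-monoˡ 0≤z x≤y ⟩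
    z * y  ≈⟨ *-comm z y ⟩
    y * z  ∎

  *-mono : ∀ {x y u v} → 0# ≤ x → 0# ≤ u → x ≤ y → u ≤ v → x * u ≤ y * v
  *-mono 0≤x 0≤u x≤y u≤v = ≤-trans (*-monoʳ 0≤u x≤y) (*-monoˡ (≤-trans 0≤x x≤y) u≤v)

  0≤x² : ∀ x → 0# ≤ x * x
  0≤x² x with total 0# x
  ... | inj₁ 0≤x = *-nonneg 0≤x 0≤x
  ... | inj₂ x≤0 = ≤-trans (*-nonneg 0≤-x 0≤-x)
      (≤-reflexive (solve 1 (λ x → (con (+ 0) :- x) :* (con (+ 0) :- x) := x :* x) refl x))
    where 0≤-x = 0≤y-x x≤0

  0≤1 : 0# ≤ 1#
  0≤1 = ≤-trans (0≤x² 1#) (≤-reflexive (*-identityˡ 1#))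

  0<1 : 0# < 1#
  0<1 = 0≤1 , 0≉1

  <⇒≤ : ∀ {x y} → x < y → x ≤ y
  <⇒≤ = proj₁

  ≰⇒> : ∀ {x y} → ¬ (x ≤ y) → y < x
  ≰⇒> = Strict.≰⇒> sym ≤-reflexive total

  <⇒≱ : ∀ {x y} → x < y → ¬ (y ≤ x)
  <⇒≱ = Strict.<⇒≱ antisym

  ≮⇒≥ : ∀ {x y} → ¬ (x < y) → y ≤ x
  ≮⇒≥ {x} {y} x≮y with em {y ≤ x}
  ... | yes y≤x = y≤x
  ... | no y≰x  = contradiction (≰⇒> y≰x) x≮y

  <-≤-trans : ∀ {x y z} → x < y → y ≤ z → x < z
  <-≤-trans x<y y≤z = ≤-trans (<⇒≤ x<y) y≤z , λ x≈z → <⇒≱ x<y (≤-trans y≤z (≤-reflexive (sym x≈z)))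

  ≤-<-trans : ∀ {x y z} → x ≤ y → y < z → x < z
  ≤-<-trans x≤y y<z = ≤-trans x≤y (<⇒≤ y<z) , λ x≈z → <⇒≱ y<z (≤-trans (≤-reflexive (sym x≈z)) x≤y)

  0<y-x : ∀ {x y} → x < y → 0# < y - x
  0<y-x {x} {y} x<y = 0≤y-x (<⇒≤ x<y) , λ 0≈y-x → proj₂ x<y (begin-equality
    x             ≈⟨ sym (+-identityˡ x) ⟩
    0# + x        ≈⟨ +-congʳ 0≈y-x ⟩
    (y - x) + x   ≈⟨ solve 2 (λ x y → (y :- x) :+ x := y) refl x y ⟩
    y             ∎)

  <-by : ∀ {x y d} → 0# < d → y ≈ x + d → x < y
  <-by {x} {y} {d} 0<d y≈x+d = ≤-by (<⇒≤ 0<d) y≈x+d , λ x≈y → proj₂ 0<d (begin-equality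
    0#            ≈⟨ sym (-‿inverseʳ x) ⟩
    x - x         ≈⟨ +-congʳ (trans x≈y y≈x+d) ⟩
    (x + d) - x   ≈⟨ solve 2 (λ x d → (x :+ d) :- x := d) refl x d ⟩
    d             ∎)

  0<⇒≉0 : ∀ {x} → 0# < x → ¬ (x ≈ 0#)
  0<⇒≉0 0<x x≈0 = proj₂ 0<x (sym x≈0)

  the-satisfies : ∀ {P : Pred ℝ 0ℓ} → ∃[ x ] P x → P (the P)
  the-satisfies {P} ∃x with em {∃[ x ] P x}
  ... | yes (x , Px) = Px
  ... | no ∄x        = contradiction ∃x ∄x

  -- x / y unfolds to x * y ⁻¹; the inverse of 0# is 0#.
  infix 9 _⁻¹
  _⁻¹ : ℝ → ℝ
  x ⁻¹ = the (λ y → x * y ≈ 1#)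

  *-inverseʳ : ∀ {x} → 0# < x → x * x ⁻¹ ≈ 1#
  *-inverseʳ 0<x = the-satisfies (invertible _ (0<⇒≉0 0<x))

  *-pos : ∀ {x y} → 0# < x → 0# < y → 0# < x * y
  *-pos {x} {y} 0<x 0<y = *-nonneg (<⇒≤ 0<x) (<⇒≤ 0<y) , λ 0≈xy → 0<⇒≉0 0<y (begin-equality
    y                   ≈⟨ sym (*-identityˡ y) ⟩
    1# * y              ≈⟨ *-congʳ (sym (*-inverseʳ 0<x)) ⟩
    (x * x ⁻¹) * y      ≈⟨ solve 3 (λ x i y → (x :* i) :* y := i :* (x :* y)) refl x (x ⁻¹) y ⟩
    x ⁻¹ * (x * y)      ≈⟨ *-congˡ (sym 0≈xy) ⟩
    x ⁻¹ * 0#           ≈⟨ zeroʳ _ ⟩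
    0#                  ∎)

  +-pos : ∀ {x y} → 0# < x → 0# ≤ y → 0# < x + y
  +-pos 0<x 0≤y = <-≤-trans 0<x (x≤x+y 0≤y)

  *-cancelˡ-≤ : ∀ {z x y} → 0# < z → z * x ≤ z * y → x ≤ y
  *-cancelˡ-≤ {z} {x} {y} 0<z zx≤zy = ≮⇒≥ λ y<x → <⇒≱ (*-pos 0<z (0<y-x y<x))
    (≤-by (0≤y-x zx≤zy) (solve 3 (λ z x y → con (+ 0) := z :* (x :- y) :+ (z :* y :- z :* x)) refl z x y))

  *-cancelˡ-≈ : ∀ {z x y} → 0# < z → z * x ≈ z * y → x ≈ y
  *-cancelˡ-≈ 0<z eq = antisym (*-cancelˡ-≤ 0<z (≤-reflexive eq)) (*-cancelˡ-≤ 0<z (≤-reflexive (sym eq)))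

  *-cancelˡ-0< : ∀ {z x} → 0# ≤ z → 0# < z * x → 0# < x
  *-cancelˡ-0< {z} {x} 0≤z 0<zx = ≰⇒> λ x≤0 → <⇒≱ 0<zx
    (≤-trans (*-monoˡ 0≤z x≤0) (≤-reflexive (zeroʳ z)))

  ⁻¹-pos : ∀ {x} → 0# < x → 0# < x ⁻¹
  ⁻¹-pos 0<x = *-cancelˡ-0< (<⇒≤ 0<x) (<-≤-trans 0<1 (≤-reflexive (sym (*-inverseʳ 0<x))))

  -- Stands in for square roots: thresholds and numbers of greedy steps are compared through their
  -- squares.
  x²≤y²⇒x≤y : ∀ {x y} → 0# ≤ y → x * x ≤ y * y → x ≤ y
  x²≤y²⇒x≤y {x} {y} 0≤y x²≤y² = ≮⇒≥ λ y<x → <⇒≱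
    (*-pos (0<y-x y<x) (<-≤-trans (≤-<-trans 0≤y y<x) (x≤x+y 0≤y)))
    (≤-by (0≤y-x x²≤y²) (solve 2 (λ x y → con (+ 0) := (x :- y) :* (x :+ y) :+ (y :* y :- x :* x)) refl x y))

  ^-nonneg : ∀ {x} n → 0# ≤ x → 0# ≤ x ^ n
  ^-nonneg zero    0≤x = 0≤1
  ^-nonneg (suc n) 0≤x = *-nonneg 0≤x (^-nonneg n 0≤x)

  ^-mono : ∀ {x y} n → 0# ≤ x → x ≤ y → x ^ n ≤ y ^ n
  ^-mono zero    0≤x x≤y = ≤-refl
  ^-mono (suc n) 0≤x x≤y = *-mono 0≤x (^-nonneg n 0≤x) x≤y (^-mono n 0≤x x≤y)

  fromℕ-+ : ∀ m n → fromℕ (m ℕ.+ n) ≈ fromℕ m + fromℕ n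
  fromℕ-+ = ×-homo-+ 1#

  fromℕ-* : ∀ m n → fromℕ (m ℕ.* n) ≈ fromℕ m * fromℕ n
  fromℕ-* = ×1-homo-*

  fromℕ-nonneg : ∀ n → 0# ≤ fromℕ n
  fromℕ-nonneg zero    = ≤-refl
  fromℕ-nonneg (suc n) = +-nonneg 0≤1 (fromℕ-nonneg n)

  fromℕ-mono : ∀ {m n} → m ℕ.≤ n → fromℕ m ≤ fromℕ n
  fromℕ-mono {n = n} z≤n = fromℕ-nonneg n
  fromℕ-mono (s≤s m≤n)   = +-monoˡ 1# (fromℕ-mono m≤n)

  fromℕ-pos : ∀ n → 0# < fromℕ (suc n)
  fromℕ-pos n = +-pos 0<1 (fromℕ-nonneg n)

  n<1+n : ∀ n → fromℕ n < fromℕ (suc n)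
  n<1+n n = <-by 0<1 (+-comm 1# (fromℕ n))

  fromℕ-cancel-≤ : ∀ {m n} → fromℕ m ≤ fromℕ n → m ℕ.≤ n
  fromℕ-cancel-≤ {m} {n} le = ℕ.≮⇒≥ λ n<m →
    <⇒≱ (n<1+n n) (≤-trans (fromℕ-mono n<m) le)

  fromℕ-∸ : ∀ {m n} → n ℕ.≤ m → fromℕ (m ℕ.∸ n) ≈ fromℕ m - fromℕ n
  fromℕ-∸ {m} {n} n≤m = begin-equality
    fromℕ (m ℕ.∸ n)                         ≈⟨ solve 2 (λ x y → x := (x :+ y) :- y) refl (fromℕ (m ℕ.∸ n)) (fromℕ n) ⟩
    (fromℕ (m ℕ.∸ n) + fromℕ n) - fromℕ n   ≈⟨ +-congʳ (sym (fromℕ-+ (m ℕ.∸ n) n)) ⟩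
    fromℕ (m ℕ.∸ n ℕ.+ n) - fromℕ n         ≈⟨ +-congʳ (×-congˡ (ℕ.m∸n+n≡m n≤m)) ⟩
    fromℕ m - fromℕ n                       ∎

  -- If `x` bounded all naturals, they would have a supremum `s`; as `suc n` is below `s` for every
  -- `n`, also `s - 1#` would bound them.
  archimedean : ∀ x → ∃[ n ] (x ≤ fromℕ n)
  archimedean x with em {∃[ n ] (x ≤ fromℕ n)}
  ... | yes ∃n = ∃n
  ... | no ∄n = ⊥-elim (<⇒≱ s-1<s (least (s - 1#) upper′))
    where
    IsNatural : Pred ℝ 0ℓ
    IsNatural y = ∃[ n ] (y ≈ fromℕ n)

    upper : IsUpperBound IsNatural x
    upper y (n , y≈n) = ≤-trans (≤-reflexive y≈n) (<⇒≤ (≰⇒> λ x≤n → ∄n (n , x≤n)))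

    sup = complete IsNatural (0# , 0 , refl) (x , upper)
    s = proj₁ sup
    least = proj₂ (proj₂ sup)

    upper′ : IsUpperBound IsNatural (s - 1#)
    upper′ y (n , y≈n) = ≤-by (0≤y-x (proj₁ (proj₂ sup) _ (suc n , refl)))
      (trans (solve 2 (λ s n → s :- con (+ 1) := n :+ (s :- (con (+ 1) :+ n))) refl s (fromℕ n))
        (+-congʳ (sym y≈n)))

    s-1<s : s - 1# < s
    s-1<s = <-by 0<1 (solve 1 (λ s → s := (s :- con (+ 1)) :+ con (+ 1)) refl s)

  leastNatural : (P : Pred ℕ 0ℓ) → ∀ n → P n → ∃[ k ] (P k × (∀ m → P m → k ℕ.≤ m))
  leastNatural P zero P0 = 0 , P0 , λ _ _ → z≤n
  leastNatural P (suc n) Pn with em {P 0} | leastNatural (λ m → P (suc m)) n Pn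
  ... | yes P0 | _ = 0 , P0 , λ _ _ → z≤n
  ... | no ¬P0 | k , Pk , k-least =
    suc k , Pk , λ { zero P0 → contradiction P0 ¬P0 ; (suc m) Pm → s≤s (k-least m Pm) }

  floor : ∀ {x} → 0# ≤ x → ∃[ n ] (fromℕ n ≤ x × x < fromℕ (suc n))
  floor {x} 0≤x with archimedean x
  ... | N , x≤N with leastNatural (λ n → x < fromℕ (suc n)) N (≤-<-trans x≤N (n<1+n N))
  ...   | zero , x<1 , _ = 0 , 0≤x , x<1
  ...   | suc n , x<n+2 , n-least = suc n , ≮⇒≥ (λ x<n+1 → ℕ.1+n≰n (n-least n x<n+1)) , x<n+2

eventually-map : ∀ {P Q : Pred ℕ 0ℓ} → (∀ n → P n → Q n) → Eventually P → Eventually Q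
eventually-map f (N , p) = N , λ n N≤n → f n (p n N≤n)

eventually-map₂ : ∀ {P Q S : Pred ℕ 0ℓ} → (∀ n → P n → Q n → S n) →
                  Eventually P → Eventually Q → Eventually S
eventually-map₂ f (M , p) (N , q) = M ℕ.+ N , λ n M+N≤n →
  f n (p n (ℕ.≤-trans (ℕ.m≤m+n M N) M+N≤n)) (q n (ℕ.≤-trans (ℕ.m≤n+m N M) M+N≤n))

-- Limits of real sequences

module Limits (em : ExcludedMiddle 0ℓ) (R : CompleteOrderedField) where
  open RealAnalysis em R
  open OrderedField em R

  infixl 7 _/2
  _/2 : ℝ → ℝ
  x /2 = x * fromℕ 2 ⁻¹

  x/2+x/2≈x : ∀ x → x /2 + x /2 ≈ x
  x/2+x/2≈x x = begin-equality
    x /2 + x /2                  ≈⟨ solve 2 (λ x i → x :* i :+ x :* i := x :* (con (+ 2) :* i)) refl x (fromℕ 2 ⁻¹) ⟩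
    x * (fromℕ 2 * fromℕ 2 ⁻¹)   ≈⟨ *-congˡ (*-inverseʳ (fromℕ-pos 1)) ⟩
    x * 1#                       ≈⟨ *-identityʳ x ⟩
    x                            ∎

  /2-pos : ∀ {x} → 0# < x → 0# < x /2
  /2-pos 0<x = *-pos 0<x (⁻¹-pos (fromℕ-pos 1))

  x/2<x : ∀ {x} → 0# < x → x /2 < x
  x/2<x {x} 0<x = <-by (/2-pos 0<x) (sym (x/2+x/2≈x x))

  infix 4 _boundedBy_
  -- This is ∣x∣ ≤ y, written as two inequalities so that no absolute value is needed.
  _boundedBy_ : ℝ → ℝ → Set
  x boundedBy y = - y ≤ x × x ≤ y

  bounded : ∀ x → ∃[ y ] (0# ≤ y × x boundedBy y)
  bounded x with total 0# x
  ... | inj₁ 0≤x = x , 0≤x , ≤-by (+-nonneg 0≤x 0≤x) (solve 1 (λ x → x := :- x :+ (x :+ x)) refl x) , ≤-refl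
  ... | inj₂ x≤0 = - x , 0≤-x , ≤-reflexive (-‿involutive x) , ≤-trans x≤0 0≤-x
    where 0≤-x = ≤-trans (≤-reflexive (sym -0#≈0#)) (neg-mono x≤0)

  boundedBy-cong : ∀ {x x′ y y′} → x ≈ x′ → y ≈ y′ → x boundedBy y → x′ boundedBy y′
  boundedBy-cong x≈x′ y≈y′ (-y≤x , x≤y) =
    ≤-trans (≤-reflexive (-‿cong (sym y≈y′))) (≤-trans -y≤x (≤-reflexive x≈x′)) ,
    ≤-trans (≤-reflexive (sym x≈x′)) (≤-trans x≤y (≤-reflexive y≈y′))

  boundedBy-weaken : ∀ {x y z} → x boundedBy y → y ≤ z → x boundedBy z
  boundedBy-weaken (-y≤x , x≤y) y≤z = ≤-trans (neg-mono y≤z) -y≤x , ≤-trans x≤y y≤z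

  boundedBy-self : ∀ {x} → 0# ≤ x → x boundedBy x
  boundedBy-self {x} 0≤x = ≤-by (+-nonneg 0≤x 0≤x) (solve 1 (λ x → x := :- x :+ (x :+ x)) refl x) , ≤-refl

  +-boundedBy : ∀ {x y u v} → x boundedBy y → u boundedBy v → x + u boundedBy (y + v)
  +-boundedBy {x} {y} {u} {v} (-y≤x , x≤y) (-v≤u , u≤v) =
    ≤-trans (≤-reflexive (solve 2 (λ y v → :- (y :+ v) := :- y :+ :- v) refl y v)) (+-mono -y≤x -v≤u) ,
    +-mono x≤y u≤v

  neg-boundedBy : ∀ {x y} → x boundedBy y → (- x) boundedBy y
  neg-boundedBy (-y≤x , x≤y) =
    neg-mono x≤y , ≤-trans (neg-mono -y≤x) (≤-reflexive (-‿involutive _))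

  -- No case distinction on signs: 2(yv + xu) = (y + x)(v + u) + (y - x)(v - u) and 2(yv - xu) = (y
  -- - x)(v + u) + (y + x)(v - u), where all four factors are nonnegative.
  *-boundedBy : ∀ {x y u v} → x boundedBy y → u boundedBy v → x * u boundedBy (y * v)
  *-boundedBy {x} {y} {u} {v} (-y≤x , x≤y) (-v≤u , u≤v) =
    *-cancelˡ-≤ (fromℕ-pos 1) (≤-by (+-nonneg (*-nonneg y+x v+u) (*-nonneg y-x v-u))
      (solve 4 (λ x y u v → con (+ 2) :* (x :* u) :=
         con (+ 2) :* (:- (y :* v)) :+ ((x :- :- y) :* (u :- :- v) :+ (y :- x) :* (v :- u))) refl x y u v)) ,
    *-cancelˡ-≤ (fromℕ-pos 1) (≤-by (+-nonneg (*-nonneg y-x v+u) (*-nonneg y+x v-u))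
      (solve 4 (λ x y u v → con (+ 2) :* (y :* v) :=
         con (+ 2) :* (x :* u) :+ ((y :- x) :* (u :- :- v) :+ (x :- :- y) :* (v :- u))) refl x y u v))
    where
    y+x = 0≤y-x -y≤x
    y-x = 0≤y-x x≤y
    v+u = 0≤y-x -v≤u
    v-u = 0≤y-x u≤v

  ^-boundedBy : ∀ {x y} n → x boundedBy y → x ^ n boundedBy (y ^ n)
  ^-boundedBy zero    x≤y = boundedBy-self 0≤1
  ^-boundedBy (suc n) x≤y = *-boundedBy x≤y (^-boundedBy n x≤y)

  ⟶⇒boundedBy : ∀ {s l} → s ⟶ l → ∀ {ε} → 0# < ε → Eventually (λ n → (s n - l) boundedBy ε)
  ⟶⇒boundedBy {s} {l} s⟶l {ε} 0<ε = eventually-map (λ n (lo , hi) →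
    ≤-by (0≤y-x (<⇒≤ lo)) (solve 3 (λ s l e → s :- l := :- e :+ (s :- (l :- e))) refl (s n) l ε) ,
    ≤-by (0≤y-x (<⇒≤ hi)) (solve 3 (λ s l e → e := (s :- l) :+ ((l :+ e) :- s)) refl (s n) l ε))
    (s⟶l ε 0<ε)

  -- The definition of `_⟶_` has strict inequalities; using the weak bound at ε/2 gains the
  -- strictness.
  boundedBy⇒⟶ : ∀ {s l} → (∀ {ε} → 0# < ε → Eventually (λ n → (s n - l) boundedBy ε)) → s ⟶ l
  boundedBy⇒⟶ {s} {l} close ε 0<ε = eventually-map (λ n (lo , hi) →
      (begin-strict
        l - ε              <⟨ <-by (0<y-x (x/2<x 0<ε)) (solve 3 (λ l e h → l :- h := l :- e :+ (e :- h)) refl l ε (ε /2)) ⟩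
        l - ε /2           ≤⟨ ≤-by (0≤y-x lo) (solve 3 (λ s l h → s := (l :- h) :+ ((s :- l) :- :- h)) refl (s n) l (ε /2)) ⟩
        s n                ∎) ,
      (begin-strict
        s n                ≤⟨ ≤-by (0≤y-x hi) (solve 3 (λ s l h → l :+ h := s :+ (h :- (s :- l))) refl (s n) l (ε /2)) ⟩
        l + ε /2           <⟨ <-by (0<y-x (x/2<x 0<ε)) (solve 3 (λ l e h → l :+ e := l :+ h :+ (e :- h)) refl l ε (ε /2)) ⟩
        l + ε              ∎))
    (close (/2-pos 0<ε))

  ⟶-cong : ∀ {s t l} → (∀ n → s n ≈ t n) → s ⟶ l → t ⟶ l
  ⟶-cong s≈t s⟶l = boundedBy⇒⟶ λ 0<ε →
    eventually-map (λ n → boundedBy-cong (+-congʳ (s≈t n)) refl) (⟶⇒boundedBy s⟶l 0<ε)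

  ⟶-respʳ-≈ : ∀ {s l m} → l ≈ m → s ⟶ l → s ⟶ m
  ⟶-respʳ-≈ l≈m s⟶l = boundedBy⇒⟶ λ 0<ε →
    eventually-map (λ n → boundedBy-cong (+-congˡ (-‿cong l≈m)) refl) (⟶⇒boundedBy s⟶l 0<ε)

  ⟶0-boundedBy : ∀ {s t} → (∀ n → s n boundedBy t n) → t ⟶ 0# → s ⟶ 0#
  ⟶0-boundedBy {s} {t} s≤t t⟶0 = boundedBy⇒⟶ λ 0<ε → eventually-map
    (λ n (_ , t-0≤ε) → boundedBy-cong (sym (x-0≈x (s n))) refl
      (boundedBy-weaken (s≤t n) (≤-trans (≤-reflexive (sym (x-0≈x (t n)))) t-0≤ε)))
    (⟶⇒boundedBy t⟶0 0<ε)
    where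
    x-0≈x : ∀ x → x - 0# ≈ x
    x-0≈x x = trans (+-congˡ -0#≈0#) (+-identityʳ x)

  ⟶-double : ∀ {s l} → s ⟶ l → (λ n → s (n ℕ.+ n)) ⟶ l
  ⟶-double s⟶l ε 0<ε = let K , close = s⟶l ε 0<ε in
    K , λ n K≤n → close (n ℕ.+ n) (ℕ.≤-trans K≤n (ℕ.m≤m+n n n))

  ⟶-const : ∀ x → (λ _ → x) ⟶ x
  ⟶-const x = boundedBy⇒⟶ λ 0<ε → 0 , λ _ _ →
    boundedBy-cong (sym (-‿inverseʳ x)) refl (boundedBy-weaken (boundedBy-self ≤-refl) (<⇒≤ 0<ε))

  ⟶-+ : ∀ {s t l m} → s ⟶ l → t ⟶ m → (λ n → s n + t n) ⟶ (l + m)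
  ⟶-+ {s} {t} {l} {m} s⟶l t⟶m = boundedBy⇒⟶ λ {ε} 0<ε →
    eventually-map₂ (λ n p q → boundedBy-cong
        (solve 4 (λ s l t m → (s :- l) :+ (t :- m) := (s :+ t) :- (l :+ m)) refl (s n) l (t n) m)
        (x/2+x/2≈x ε) (+-boundedBy p q))
      (⟶⇒boundedBy s⟶l (/2-pos 0<ε)) (⟶⇒boundedBy t⟶m (/2-pos 0<ε))

  ⟶-neg : ∀ {s l} → s ⟶ l → (λ n → - s n) ⟶ (- l)
  ⟶-neg {s} {l} s⟶l = boundedBy⇒⟶ λ 0<ε → eventually-map (λ n p → boundedBy-cong
      (solve 2 (λ s l → :- (s :- l) := :- s :- :- l) refl (s n) l) refl (neg-boundedBy p))
    (⟶⇒boundedBy s⟶l 0<ε)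

  ⟶-* : ∀ {s t l m} → s ⟶ l → t ⟶ m → (λ n → s n * t n) ⟶ (l * m)
  ⟶-* {s} {t} {l} {m} s⟶l t⟶m = boundedBy⇒⟶ close
    where
    L = proj₁ (bounded l)
    M = proj₁ (bounded m)
    0≤L = proj₁ (proj₂ (bounded l))
    0≤M = proj₁ (proj₂ (bounded m))
    -- One bound for both terms of st - lm = (s - l)t + l(t - m): ∣l∣ ≤ `L`, and eventually ∣t∣ ≤ 1
    -- + `M`.
    B = 1# + (L + M)

    0<B : 0# < B
    0<B = +-pos 0<1 (+-nonneg 0≤L 0≤M)

    l-bounded : l boundedBy B
    l-bounded = boundedBy-weaken (proj₂ (proj₂ (bounded l)))
      (≤-by (+-nonneg 0≤1 0≤M) (solve 2 (λ L M → con (+ 1) :+ (L :+ M) := L :+ (con (+ 1) :+ M)) refl L M))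

    t-bounded : Eventually (λ n → t n boundedBy B)
    t-bounded = eventually-map (λ n p → boundedBy-weaken
        (boundedBy-cong (solve 2 (λ t m → (t :- m) :+ m := t) refl (t n) m) refl
          (+-boundedBy p (proj₂ (proj₂ (bounded m)))))
        (≤-by 0≤L (solve 2 (λ L M → con (+ 1) :+ (L :+ M) := (con (+ 1) :+ M) :+ L) refl L M)))
      (⟶⇒boundedBy t⟶m 0<1)

    close : ∀ {ε} → 0# < ε → Eventually (λ n → (s n * t n - l * m) boundedBy ε)
    close {ε} 0<ε = eventually-map₂ (λ n (p , tB) q → boundedBy-cong
          (solve 4 (λ s l t m → (s :- l) :* t :+ l :* (t :- m) := s :* t :- l :* m) refl (s n) l (t n) m)
          δB+Bδ≈ε (+-boundedBy (*-boundedBy p tB) (*-boundedBy l-bounded q)))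
        (eventually-map₂ (λ n p q → p , q) (⟶⇒boundedBy s⟶l 0<δ) t-bounded)
        (⟶⇒boundedBy t⟶m 0<δ)
      where
      δ = ε /2 * B ⁻¹

      0<δ : 0# < δ
      0<δ = *-pos (/2-pos 0<ε) (⁻¹-pos 0<B)

      δB+Bδ≈ε : δ * B + B * δ ≈ ε
      δB+Bδ≈ε = begin-equality
        δ * B + B * δ                         ≈⟨ solve 3 (λ h B i → (h :* i) :* B :+ B :* (h :* i) := (h :+ h) :* (B :* i)) refl (ε /2) B (B ⁻¹) ⟩
        (ε /2 + ε /2) * (B * B ⁻¹)            ≈⟨ *-cong (x/2+x/2≈x ε) (*-inverseʳ 0<B) ⟩
        ε * 1#                                ≈⟨ *-identityʳ ε ⟩
        ε                                     ∎

  ⟶-≤ : ∀ {s t l m} → s ⟶ l → t ⟶ m → Eventually (λ n → s n ≤ t n) → l ≤ m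
  ⟶-≤ {s} {t} {l} {m} s⟶l t⟶m s≤t = ≮⇒≥ λ m<l →
    -- Half the gap: m + h = l - h separates the two sequences eventually.
    let 0<h = /2-pos (0<y-x m<l)
        N , both = eventually-map₂ (λ n (p , st) q → p , st , q)
          (eventually-map₂ (λ n p q → p , q) (s⟶l _ 0<h) s≤t) (t⟶m _ 0<h)
        (l-h<s , _) , s≤t , (_ , t<m+h) = both N ℕ.≤-refl
    in <⇒≱ (≤-<-trans s≤t t<m+h) (≤-trans (≤-reflexive (m+h≈l-h ((l - m) /2) (x/2+x/2≈x (l - m)))) (<⇒≤ l-h<s))
    where
    m+h≈l-h : ∀ h → h + h ≈ l - m → m + h ≈ l - h
    m+h≈l-h h eq = begin-equality
      m + h             ≈⟨ solve 2 (λ m h → m :+ h := (m :+ (h :+ h)) :- h) refl m h ⟩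
      m + (h + h) - h   ≈⟨ +-congʳ (+-congˡ eq) ⟩
      m + (l - m) - h   ≈⟨ solve 3 (λ m l h → m :+ (l :- m) :- h := l :- h) refl m l h ⟩
      l - h             ∎

  ⟶0⇒eventually≤ : ∀ {s} → s ⟶ 0# → ∀ {m} → 0# < m → Eventually (λ n → s n ≤ m)
  ⟶0⇒eventually≤ s⟶0 {m} 0<m = eventually-map (λ n (_ , s<0+m) → ≤-trans (<⇒≤ s<0+m) (≤-reflexive (+-identityˡ m)))
    (s⟶0 m 0<m)

  ⟶∞-*ˡ : ∀ {s c} → 0# < c → s ⟶∞ → (λ n → c * s n) ⟶∞
  ⟶∞-*ˡ {s} {c} 0<c s⟶∞ M = eventually-map (λ n c⁻¹M≤s → begin
      M                  ≈⟨ sym (trans (*-congʳ (*-inverseʳ 0<c)) (*-identityˡ M)) ⟩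
      c * c ⁻¹ * M       ≈⟨ *-assoc c (c ⁻¹) M ⟩
      c * (c ⁻¹ * M)     ≤⟨ *-monoˡ (<⇒≤ 0<c) c⁻¹M≤s ⟩
      c * s n            ∎)
    (s⟶∞ (c ⁻¹ * M))

  ⟶∞⇒⁻¹⟶0 : ∀ {s} → s ⟶∞ → (λ n → s n ⁻¹) ⟶ 0#
  ⟶∞⇒⁻¹⟶0 {s} s⟶∞ = boundedBy⇒⟶ λ {ε} 0<ε → eventually-map (λ n 1≤εs →
    -- Since εs ≥ 1 forces s > 0, the inverse is a true one and not the default value 0.
    let 0<s = *-cancelˡ-0< (<⇒≤ 0<ε) (<-≤-trans 0<1 1≤εs)
        s⁻¹≤ε = *-cancelˡ-≤ 0<s (≤-trans (≤-reflexive (*-inverseʳ 0<s)) (≤-trans 1≤εs (≤-reflexive (*-comm ε (s n)))))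
    in boundedBy-cong (sym (trans (+-congˡ -0#≈0#) (+-identityʳ _))) refl
         (boundedBy-weaken (boundedBy-self (<⇒≤ (⁻¹-pos 0<s))) s⁻¹≤ε))
    (⟶∞-*ˡ 0<ε s⟶∞ 1#)

  ⟶-unique : ∀ {s l m} → s ⟶ l → s ⟶ m → l ≈ m
  ⟶-unique s⟶l s⟶m = antisym (⟶-≤ s⟶l s⟶m (0 , λ _ _ → ≤-refl)) (⟶-≤ s⟶m s⟶l (0 , λ _ _ → ≤-refl))

  ⟶-lim : ∀ {s l} → s ⟶ l → s ⟶ lim s
  ⟶-lim {s} s⟶l = the-satisfies {P = s ⟶_} (_ , s⟶l)

  module _ {s : ℕ → ℝ} (increasing : ∀ n → s n ≤ s (suc n)) where

    increasing⇒monotone : ∀ {m n} → m ℕ.≤ n → s m ≤ s n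
    increasing⇒monotone m≤n = go (ℕ.≤⇒≤′ m≤n)
      where
      go : ∀ {m n} → m ℕ.≤′ n → s m ≤ s n
      go ℕ.≤′-refl       = ≤-refl
      go (ℕ.≤′-step m≤n) = ≤-trans (go m≤n) (increasing _)

    increasing-bounded⇒⟶ : ∀ u → (∀ n → s n ≤ u) → ∃[ l ] (s ⟶ l)
    increasing-bounded⇒⟶ u s≤u = S , converges
      where
      Value : Pred ℝ 0ℓ
      Value y = ∃[ n ] (y ≈ s n)

      sup = complete Value (s 0 , 0 , refl) (u , λ y (n , y≈s) → ≤-trans (≤-reflexive y≈s) (s≤u n))
      S = proj₁ sup

      converges : s ⟶ S
      converges ε 0<ε with em {∃[ n ] (S - ε < s n)}
      ... | yes (N , S-ε<s) = N , λ n N≤n → <-≤-trans S-ε<s (increasing⇒monotone N≤n) ,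
              ≤-<-trans (proj₁ (proj₂ sup) _ (n , refl)) (<-by 0<ε refl)
      ... | no ∄n = contradiction
              (proj₂ (proj₂ sup) (S - ε) λ y (n , y≈s) → ≤-trans (≤-reflexive y≈s) (≮⇒≥ λ lt → ∄n (n , lt)))
              (<⇒≱ (<-by 0<ε (solve 2 (λ S e → S := S :- e :+ e) refl S ε)))

-- The exponential series and the logarithm

module Series (em : ExcludedMiddle 0ℓ) (R : CompleteOrderedField) where
  open RealAnalysis em R
  open OrderedField em R
  open Limits em R
  open import Algebra.Properties.CommutativeMonoid.Sum (CompleteOrderedField.+-commutativeMonoid R)
    using (sum-syntax; sum-init-last; sum-cong-≗)

  -- Splits off the last term, so that partial sums grow by one term at a time. The library sum in
  -- `exp` splits off the first; `∑≈Σ` reconciles the two.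
  Σ : ℕ → (ℕ → ℝ) → ℝ
  Σ zero    f = 0#
  Σ (suc n) f = Σ n f + f n

  Σ-cong : ∀ n {f g} → (∀ i → i ℕ.< n → f i ≈ g i) → Σ n f ≈ Σ n g
  Σ-cong zero    f≈g = refl
  Σ-cong (suc n) f≈g = +-cong (Σ-cong n (λ i i<n → f≈g i (ℕ.m≤n⇒m≤1+n i<n))) (f≈g n ℕ.≤-refl)

  Σ-mono : ∀ n {f g} → (∀ i → i ℕ.< n → f i ≤ g i) → Σ n f ≤ Σ n g
  Σ-mono zero    f≤g = ≤-refl
  Σ-mono (suc n) f≤g = +-mono (Σ-mono n (λ i i<n → f≤g i (ℕ.m≤n⇒m≤1+n i<n))) (f≤g n ℕ.≤-refl)

  Σ-boundedBy : ∀ n {f g} → (∀ i → f i boundedBy g i) → Σ n f boundedBy Σ n g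
  Σ-boundedBy zero    f≤g = boundedBy-self ≤-refl
  Σ-boundedBy (suc n) f≤g = +-boundedBy (Σ-boundedBy n f≤g) (f≤g n)

  Σ-+ : ∀ n f g → Σ n (λ i → f i + g i) ≈ Σ n f + Σ n g
  Σ-+ zero    f g = sym (+-identityˡ 0#)
  Σ-+ (suc n) f g = trans (+-congʳ (Σ-+ n f g))
    (solve 4 (λ a b c d → (a :+ b) :+ (c :+ d) := (a :+ c) :+ (b :+ d)) refl (Σ n f) (Σ n g) (f n) (g n))

  Σ-*ˡ : ∀ n x f → Σ n (λ i → x * f i) ≈ x * Σ n f
  Σ-*ˡ zero    x f = sym (zeroʳ x)
  Σ-*ˡ (suc n) x f = trans (+-congʳ (Σ-*ˡ n x f)) (sym (distribˡ x _ _))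

  Σ-*ʳ : ∀ n x f → Σ n (λ i → f i * x) ≈ Σ n f * x
  Σ-*ʳ n x f = trans (Σ-cong n (λ i _ → *-comm (f i) x)) (trans (Σ-*ˡ n x f) (*-comm x _))

  Σ-head : ∀ n f → Σ (suc n) f ≈ f 0 + Σ n (λ i → f (suc i))
  Σ-head zero    f = +-comm 0# (f 0)
  Σ-head (suc n) f = trans (+-congʳ (Σ-head n f)) (+-assoc _ _ _)

  Σ-monotone : ∀ {f m n} → (∀ i → 0# ≤ f i) → m ℕ.≤ n → Σ m f ≤ Σ n f
  Σ-monotone 0≤f = increasing⇒monotone (λ i → x≤x+y (0≤f i))

  Σ-difference-boundedBy : ∀ {f g m n} → (∀ i → f i boundedBy g i) → m ℕ.≤ n →
                           (Σ n f - Σ m f) boundedBy (Σ n g - Σ m g)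
  Σ-difference-boundedBy {f} {g} f≤g m≤n = go (ℕ.≤⇒≤′ m≤n)
    where
    regroup : ∀ h m n → (Σ n h - Σ m h) + h n ≈ Σ (suc n) h - Σ m h
    regroup h m n = solve 3 (λ a b c → (a :- b) :+ c := (a :+ c) :- b) refl (Σ n h) (Σ m h) (h n)

    go : ∀ {m n} → m ℕ.≤′ n → (Σ n f - Σ m f) boundedBy (Σ n g - Σ m g)
    go {m} ℕ.≤′-refl = boundedBy-cong (sym (-‿inverseʳ _)) (sym (-‿inverseʳ _)) (boundedBy-self ≤-refl)
    go {m} (ℕ.≤′-step {n} m≤n) = boundedBy-cong (regroup f m n) (regroup g m n) (+-boundedBy (go m≤n) (f≤g n))

  ∑≈Σ : ∀ n f → ∑[ k < n ] f (toℕ k) ≈ Σ n f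
  ∑≈Σ zero    f = refl
  ∑≈Σ (suc n) f = begin-equality
    ∑[ k < suc n ] f (toℕ k)                                   ≈⟨ sum-init-last {n} (λ k → f (toℕ k)) ⟩
    ∑[ k < n ] f (toℕ (Fin.inject₁ k)) + f (toℕ (Fin.fromℕ n)) ≈⟨ +-cong
        (reflexive (sum-cong-≗ {n} (λ k → ≡.cong f (Fin.toℕ-inject₁ k)))) (reflexive (≡.cong f (Fin.toℕ-fromℕ n))) ⟩
    ∑[ k < n ] f (toℕ k) + f n                                 ≈⟨ +-congʳ (∑≈Σ n f) ⟩
    Σ n f + f n                                                ∎

  expTerm : ℝ → ℕ → ℝ
  expTerm x k = x ^ k / fromℕ (k !)

  expSum : ℝ → ℕ → ℝ
  expSum x n = Σ n (expTerm x)

  0<k! : ∀ k → 0# < fromℕ (k !)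
  0<k! k = <-≤-trans (fromℕ-pos 0) (fromℕ-mono (ℕ.1≤n! k))

  k!*expTerm : ∀ x k → fromℕ (k !) * expTerm x k ≈ x ^ k
  k!*expTerm x k = begin-equality
    fromℕ (k !) * (x ^ k * fromℕ (k !) ⁻¹)   ≈⟨ solve 3 (λ a b c → a :* (b :* c) := b :* (a :* c)) refl _ _ _ ⟩
    x ^ k * (fromℕ (k !) * fromℕ (k !) ⁻¹)   ≈⟨ *-congˡ (*-inverseʳ (0<k! k)) ⟩
    x ^ k * 1#                               ≈⟨ *-identityʳ _ ⟩
    x ^ k                                    ∎

  expTerm-zero : ∀ x → expTerm x 0 ≈ 1#
  expTerm-zero x = begin-equality
    expTerm x 0               ≈⟨ sym (*-identityˡ _) ⟩
    1# * expTerm x 0          ≈⟨ *-congʳ (sym (+-identityʳ 1#)) ⟩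
    fromℕ 1 * expTerm x 0     ≈⟨ k!*expTerm x 0 ⟩
    1#                        ∎

  expTerm-suc : ∀ x k → fromℕ (suc k) * expTerm x (suc k) ≈ x * expTerm x k
  expTerm-suc x k = *-cancelˡ-≈ (0<k! k) (begin-equality
    fromℕ (k !) * (fromℕ (suc k) * expTerm x (suc k))   ≈⟨ solve 3 (λ a b c → a :* (b :* c) := (b :* a) :* c) refl _ _ _ ⟩
    (fromℕ (suc k) * fromℕ (k !)) * expTerm x (suc k)   ≈⟨ *-congʳ (sym (fromℕ-* (suc k) (k !))) ⟩
    fromℕ (suc k !) * expTerm x (suc k)                 ≈⟨ k!*expTerm x (suc k) ⟩
    x * x ^ k                                           ≈⟨ *-congˡ (sym (k!*expTerm x k)) ⟩
    x * (fromℕ (k !) * expTerm x k)                     ≈⟨ solve 3 (λ a b c → a :* (b :* c) := b :* (a :* c)) refl _ _ _ ⟩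
    fromℕ (k !) * (x * expTerm x k)                     ∎)

  expTerm-boundedBy : ∀ {x y} → x boundedBy y → ∀ k → expTerm x k boundedBy expTerm y k
  expTerm-boundedBy x≤y k = *-boundedBy (^-boundedBy k x≤y) (boundedBy-self (<⇒≤ (⁻¹-pos (0<k! k))))

  expTerm-nonneg : ∀ {x} → 0# ≤ x → ∀ k → 0# ≤ expTerm x k
  expTerm-nonneg 0≤x k = *-nonneg (^-nonneg k 0≤x) (<⇒≤ (⁻¹-pos (0<k! k)))

  -- From index `K` ≥ 2x on, each term is at most half of the one before. Hence the partial sum plus
  -- twice the next term no longer increases.
  expSum-upperBound : ∀ {x} → 0# ≤ x → ∃[ u ] (∀ n → expSum x n ≤ u)
  expSum-upperBound {x} 0≤x = expSum x K + fromℕ 2 * expTerm x K , bound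
    where
    K = proj₁ (archimedean (fromℕ 2 * x))

    2x≤K : fromℕ 2 * x ≤ fromℕ K
    2x≤K = proj₂ (archimedean (fromℕ 2 * x))

    0≤t = expTerm-nonneg 0≤x

    halves : ∀ k → K ℕ.≤ k → fromℕ 2 * expTerm x (suc k) ≤ expTerm x k
    halves k K≤k = *-cancelˡ-≤ (fromℕ-pos k) (begin
      fromℕ (suc k) * (fromℕ 2 * expTerm x (suc k))   ≈⟨ solve 3 (λ a b c → a :* (b :* c) := b :* (a :* c)) refl _ _ _ ⟩
      fromℕ 2 * (fromℕ (suc k) * expTerm x (suc k))   ≈⟨ *-congˡ (expTerm-suc x k) ⟩
      fromℕ 2 * (x * expTerm x k)                     ≈⟨ sym (*-assoc _ _ _) ⟩
      fromℕ 2 * x * expTerm x k                       ≤⟨ *-monoʳ (0≤t k) (≤-trans 2x≤K (fromℕ-mono (ℕ.m≤n⇒m≤1+n K≤k))) ⟩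
      fromℕ (suc k) * expTerm x k                     ∎)

    decreasing : ∀ {n} → K ℕ.≤′ n → expSum x n + fromℕ 2 * expTerm x n ≤ expSum x K + fromℕ 2 * expTerm x K
    decreasing ℕ.≤′-refl = ≤-refl
    decreasing (ℕ.≤′-step {n} K≤n) = ≤-trans (begin
      expSum x n + expTerm x n + fromℕ 2 * expTerm x (suc n)   ≤⟨ +-monoˡ _ (halves n (ℕ.≤′⇒≤ K≤n)) ⟩
      expSum x n + expTerm x n + expTerm x n                   ≈⟨ solve 2 (λ a b → a :+ b :+ b := a :+ con (+ 2) :* b) refl _ _ ⟩
      expSum x n + fromℕ 2 * expTerm x n                       ∎) (decreasing K≤n)

    bound : ∀ n → expSum x n ≤ expSum x K + fromℕ 2 * expTerm x K
    bound n = begin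
      expSum x n                                              ≤⟨ Σ-monotone 0≤t (ℕ.m≤n+m n K) ⟩
      expSum x (K ℕ.+ n)                                      ≤⟨ x≤x+y (*-nonneg (fromℕ-nonneg 2) (0≤t (K ℕ.+ n))) ⟩
      expSum x (K ℕ.+ n) + fromℕ 2 * expTerm x (K ℕ.+ n)      ≤⟨ decreasing (ℕ.≤⇒≤′ (ℕ.m≤m+n K n)) ⟩
      expSum x K + fromℕ 2 * expTerm x K                      ∎

  expSum-nonneg-converges : ∀ {x} → 0# ≤ x → ∃[ l ] (expSum x ⟶ l)
  expSum-nonneg-converges 0≤x = let u , bound = expSum-upperBound 0≤x in
    increasing-bounded⇒⟶ (λ n → x≤x+y (expTerm-nonneg 0≤x n)) u bound

  -- With ∣x∣ ≤ y, the sums of expTerm x + expTerm y increase, and expSum x is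
  -- their difference with expSum y.
  expSum-converges : ∀ x → ∃[ l ] (expSum x ⟶ l)
  expSum-converges x = _ , ⟶-cong
      (λ n → solve 2 (λ a b → (a :+ b) :- b := a) refl (expSum x n) (expSum y n))
      (⟶-+ (proj₂ total-converges) (⟶-neg (proj₂ (expSum-nonneg-converges 0≤y))))
    where
    y = proj₁ (bounded x)
    0≤y = proj₁ (proj₂ (bounded x))
    x≤y = proj₂ (proj₂ (bounded x))
    u = proj₁ (expSum-upperBound 0≤y)
    y-bound = proj₂ (expSum-upperBound 0≤y)

    total-converges : ∃[ l ] ((λ n → expSum x n + expSum y n) ⟶ l)
    total-converges = increasing-bounded⇒⟶
      (λ n → ≤-by (0≤y-x (proj₁ (expTerm-boundedBy x≤y n)))
        (solve 4 (λ a b c d → (a :+ b) :+ (c :+ d) := a :+ c :+ (b :- :- d)) refl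
          (expSum x n) (expTerm x n) (expSum y n) (expTerm y n)))
      (u + u)
      (λ n → +-mono (≤-trans (proj₂ (Σ-boundedBy n (expTerm-boundedBy x≤y))) (y-bound n)) (y-bound n))

  expSum⟶exp : ∀ x → expSum x ⟶ exp x
  expSum⟶exp x = ⟶-cong (λ n → ∑≈Σ n (expTerm x))
    (⟶-lim (⟶-cong (λ n → sym (∑≈Σ n (expTerm x))) (proj₂ (expSum-converges x))))

  convolution : (ℕ → ℝ) → (ℕ → ℝ) → ℕ → ℝ
  convolution f g n = Σ (suc n) (λ i → f i * g (n ℕ.∸ i))

  -- Partial sum of the Cauchy product: it runs over the pairs i + j < n, and `convolution` is the
  -- diagonal i + j = n that the next partial sum adds.
  triangleSum : (ℕ → ℝ) → (ℕ → ℝ) → ℕ → ℝ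
  triangleSum f g n = Σ n (λ i → f i * Σ (n ℕ.∸ i) g)

  triangleSum-suc : ∀ f g n → triangleSum f g (suc n) ≈ triangleSum f g n + convolution f g n
  triangleSum-suc f g n = begin-equality
    Σ (suc n) (λ i → f i * Σ (suc n ℕ.∸ i) g)                                    ≈⟨ Σ-cong (suc n) (λ i i<1+n → split i (ℕ.s≤s⁻¹ i<1+n)) ⟩
    Σ (suc n) (λ i → f i * Σ (n ℕ.∸ i) g + f i * g (n ℕ.∸ i))                    ≈⟨ Σ-+ (suc n) _ _ ⟩
    triangleSum f g n + f n * Σ (n ℕ.∸ n) g + convolution f g n                  ≈⟨ +-congʳ (trans (+-congˡ last≈0) (+-identityʳ _)) ⟩
    triangleSum f g n + convolution f g n                                        ∎
    where
    split : ∀ i → i ℕ.≤ n → f i * Σ (suc n ℕ.∸ i) g ≈ f i * Σ (n ℕ.∸ i) g + f i * g (n ℕ.∸ i)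
    split i i≤n rewrite ℕ.+-∸-assoc 1 i≤n = distribˡ _ _ _

    last≈0 : f n * Σ (n ℕ.∸ n) g ≈ 0#
    last≈0 rewrite ℕ.n∸n≡0 n = zeroʳ _

  product-triangleSum : ∀ f g n →
    Σ n f * Σ n g - triangleSum f g n ≈ Σ n (λ i → f i * (Σ n g - Σ (n ℕ.∸ i) g))
  product-triangleSum f g n = sym (begin-equality
    Σ n (λ i → f i * (Σ n g - Σ (n ℕ.∸ i) g))                          ≈⟨ Σ-cong n (λ i _ →
        solve 3 (λ a b c → a :* (b :- c) := a :* b :+ con (-[1+ 0 ]) :* (a :* c)) refl (f i) (Σ n g) (Σ (n ℕ.∸ i) g)) ⟩
    Σ n (λ i → f i * Σ n g + - fromℕ 1 * (f i * Σ (n ℕ.∸ i) g))        ≈⟨ Σ-+ n _ _ ⟩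
    Σ n (λ i → f i * Σ n g) + Σ n (λ i → - fromℕ 1 * (f i * Σ (n ℕ.∸ i) g))  ≈⟨ +-cong (Σ-*ʳ n _ f) (Σ-*ˡ n _ _) ⟩
    Σ n f * Σ n g + - fromℕ 1 * triangleSum f g n                      ≈⟨
        solve 2 (λ a b → a :+ con (-[1+ 0 ]) :* b := a :- b) refl _ _ ⟩
    Σ n f * Σ n g - triangleSum f g n                                  ∎)

  -- By `product-triangleSum` the gap is a sum of terms `f i` times blocks of consecutive terms of
  -- `g`; both factors inherit the termwise bounds.
  product-triangleSum-boundedBy : ∀ {f g f′ g′} → (∀ i → f i boundedBy f′ i) → (∀ i → g i boundedBy g′ i) → ∀ n →
    (Σ n f * Σ n g - triangleSum f g n) boundedBy (Σ n f′ * Σ n g′ - triangleSum f′ g′ n)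
  product-triangleSum-boundedBy {f} {g} {f′} {g′} f≤f′ g≤g′ n = boundedBy-cong
    (sym (product-triangleSum f g n)) (sym (product-triangleSum f′ g′ n))
    (Σ-boundedBy n λ i → *-boundedBy (f≤f′ i) (Σ-difference-boundedBy g≤g′ (ℕ.m∸n≤m n i)))

  product≤triangleSum : ∀ {f g} → (∀ i → 0# ≤ f i) → (∀ i → 0# ≤ g i) → ∀ n →
    Σ n f * Σ n g ≤ triangleSum f g (n ℕ.+ n)
  product≤triangleSum {f} {g} 0≤f 0≤g n = begin
    Σ n f * Σ n g                                   ≈⟨ sym (Σ-*ʳ n _ f) ⟩
    Σ n (λ i → f i * Σ n g)                         ≤⟨ Σ-mono n (λ i i<n → *-monoˡ (0≤f i) (Σ-monotone 0≤g
        (ℕ.≤-trans (ℕ.m≤m+n n (n ℕ.∸ i)) (ℕ.≤-reflexive (≡.sym (ℕ.+-∸-assoc n (ℕ.<⇒≤ i<n))))))) ⟩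
    Σ n (λ i → f i * Σ (n ℕ.+ n ℕ.∸ i) g)           ≤⟨ Σ-monotone (λ i → *-nonneg (0≤f i)
        (Σ-monotone {m = 0} {n ℕ.+ n ℕ.∸ i} 0≤g z≤n)) (ℕ.m≤m+n n n) ⟩
    triangleSum f g (n ℕ.+ n)                       ∎

  -- The binomial theorem without binomial coefficients. Multiply by n + 1 = i + (n + 1 - i) and
  -- absorb each summand by `expTerm-suc`: the first lowers the index of `x`, the second that of
  -- `y`, and both leave the convolution of order n.
  expTerm-convolution : ∀ x y n → convolution (expTerm x) (expTerm y) n ≈ expTerm (x + y) n
  expTerm-convolution x y zero = begin-equality
    0# + expTerm x 0 * expTerm y 0   ≈⟨ +-congˡ (*-cong (expTerm-zero x) (expTerm-zero y)) ⟩
    0# + 1# * 1#                     ≈⟨ trans (+-identityˡ _) (*-identityˡ _) ⟩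
    1#                               ≈⟨ sym (expTerm-zero (x + y)) ⟩
    expTerm (x + y) 0                ∎
  expTerm-convolution x y (suc n) = *-cancelˡ-≈ (fromℕ-pos n) (begin-equality
    fromℕ (suc n) * convolution f g (suc n)                           ≈⟨ sym (Σ-*ˡ (suc (suc n)) _ _) ⟩
    Σ (suc (suc n)) (λ i → fromℕ (suc n) * (f i * g (suc n ℕ.∸ i)))   ≈⟨ Σ-cong (suc (suc n)) (λ i i<2+n → weigh i (ℕ.s≤s⁻¹ i<2+n)) ⟩
    Σ (suc (suc n)) (λ i → fromℕ i * f i * g (suc n ℕ.∸ i) + f i * (fromℕ (suc n ℕ.∸ i) * g (suc n ℕ.∸ i)))
                                                                      ≈⟨ Σ-+ (suc (suc n)) _ _ ⟩
    Σ (suc (suc n)) (λ i → fromℕ i * f i * g (suc n ℕ.∸ i)) +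
    Σ (suc (suc n)) (λ i → f i * (fromℕ (suc n ℕ.∸ i) * g (suc n ℕ.∸ i)))
                                                                      ≈⟨ +-cong left right ⟩
    x * convolution f g n + y * convolution f g n                     ≈⟨ sym (distribʳ _ x y) ⟩
    (x + y) * convolution f g n                                       ≈⟨ *-congˡ (expTerm-convolution x y n) ⟩
    (x + y) * expTerm (x + y) n                                       ≈⟨ sym (expTerm-suc (x + y) n) ⟩
    fromℕ (suc n) * expTerm (x + y) (suc n)                           ∎)
    where
    f = expTerm x
    g = expTerm y

    weigh : ∀ i → i ℕ.≤ suc n → fromℕ (suc n) * (f i * g (suc n ℕ.∸ i)) ≈
            fromℕ i * f i * g (suc n ℕ.∸ i) + f i * (fromℕ (suc n ℕ.∸ i) * g (suc n ℕ.∸ i))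
    weigh i i≤1+n = trans
      (*-congʳ (trans (×-congˡ (≡.sym (ℕ.m+[n∸m]≡n i≤1+n))) (fromℕ-+ i (suc n ℕ.∸ i))))
      (solve 4 (λ a b c d → (a :+ b) :* (c :* d) := a :* c :* d :+ c :* (b :* d)) refl
        (fromℕ i) (fromℕ (suc n ℕ.∸ i)) (f i) (g (suc n ℕ.∸ i)))

    left : Σ (suc (suc n)) (λ i → fromℕ i * f i * g (suc n ℕ.∸ i)) ≈ x * convolution f g n
    left = begin-equality
      Σ (suc (suc n)) (λ i → fromℕ i * f i * g (suc n ℕ.∸ i))              ≈⟨ Σ-head (suc n) _ ⟩
      0# * f 0 * g (suc n) + Σ (suc n) (λ i → fromℕ (suc i) * f (suc i) * g (n ℕ.∸ i))
                                                                           ≈⟨ +-cong (trans (*-congʳ (zeroˡ _)) (zeroˡ _))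
          (Σ-cong (suc n) (λ i _ → trans (*-congʳ (expTerm-suc x i)) (*-assoc x _ _))) ⟩
      0# + Σ (suc n) (λ i → x * (f i * g (n ℕ.∸ i)))                       ≈⟨ trans (+-identityˡ _) (Σ-*ˡ (suc n) x _) ⟩
      x * convolution f g n                                                ∎

    shift : ∀ i → i ℕ.≤ n → f i * (fromℕ (suc n ℕ.∸ i) * g (suc n ℕ.∸ i)) ≈ y * (f i * g (n ℕ.∸ i))
    shift i i≤n rewrite ℕ.+-∸-assoc 1 i≤n = trans (*-congˡ (expTerm-suc y (n ℕ.∸ i)))
      (solve 3 (λ a b c → a :* (b :* c) := b :* (a :* c)) refl _ _ _)

    last≈0 : f (suc n) * (fromℕ (n ℕ.∸ n) * g (n ℕ.∸ n)) ≈ 0#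
    last≈0 rewrite ℕ.n∸n≡0 n = trans (*-congˡ (zeroˡ _)) (zeroʳ _)

    right : Σ (suc (suc n)) (λ i → f i * (fromℕ (suc n ℕ.∸ i) * g (suc n ℕ.∸ i))) ≈ y * convolution f g n
    right = trans (+-cong
        (trans (Σ-cong (suc n) (λ i i<1+n → shift i (ℕ.s≤s⁻¹ i<1+n))) (Σ-*ˡ (suc n) y _)) last≈0)
      (+-identityʳ _)

  expTerm-triangleSum : ∀ x y n → triangleSum (expTerm x) (expTerm y) n ≈ expSum (x + y) n
  expTerm-triangleSum x y zero    = refl
  expTerm-triangleSum x y (suc n) = trans (triangleSum-suc _ _ n)
    (+-cong (expTerm-triangleSum x y n) (expTerm-convolution x y n))

  -- The terms missing from the triangle i + j < n in the square i, j < n are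
  -- dominated by their analogues for bounds of ∣x∣ and ∣y∣, and these lie in the
  -- triangle i + j < 2n.
  exp-+ : ∀ x y → exp (x + y) ≈ exp x * exp y
  exp-+ x y = ⟶-unique (expSum⟶exp (x + y)) (⟶-respʳ-≈ (trans (+-congˡ -0#≈0#) (+-identityʳ _))
      (⟶-cong (λ n → solve 2 (λ p t → p :- (p :- t) := t) refl (expSum x n * expSum y n) (expSum (x + y) n))
        (⟶-+ (⟶-* (expSum⟶exp x) (expSum⟶exp y)) (⟶-neg gap⟶0))))
    where
    X = proj₁ (bounded x)
    Y = proj₁ (bounded y)
    0≤X = proj₁ (proj₂ (bounded x))
    0≤Y = proj₁ (proj₂ (bounded y))

    gap-boundedBy : ∀ n → (expSum x n * expSum y n - expSum (x + y) n) boundedBy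
                          (expSum (X + Y) (n ℕ.+ n) - expSum (X + Y) n)
    gap-boundedBy n = boundedBy-weaken
      (boundedBy-cong (+-congˡ (-‿cong (expTerm-triangleSum x y n))) (+-congˡ (-‿cong (expTerm-triangleSum X Y n)))
        (product-triangleSum-boundedBy
          (expTerm-boundedBy (proj₂ (proj₂ (bounded x)))) (expTerm-boundedBy (proj₂ (proj₂ (bounded y)))) n))
      (+-mono (≤-trans (product≤triangleSum (expTerm-nonneg 0≤X) (expTerm-nonneg 0≤Y) n)
                (≤-reflexive (expTerm-triangleSum X Y (n ℕ.+ n)))) ≤-refl)

    gap⟶0 : (λ n → expSum x n * expSum y n - expSum (x + y) n) ⟶ 0#
    gap⟶0 = ⟶0-boundedBy gap-boundedBy (⟶-respʳ-≈ (-‿inverseʳ _)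
      (⟶-+ (⟶-double (expSum⟶exp (X + Y))) (⟶-neg (expSum⟶exp (X + Y)))))

  exp-cong : ∀ {x y} → x ≈ y → exp x ≈ exp y
  exp-cong {x} {y} x≈y = ⟶-unique
    (⟶-cong (λ n → Σ-cong n (λ k _ → *-congʳ (^-congˡ k x≈y))) (expSum⟶exp x)) (expSum⟶exp y)

  exp-0 : exp 0# ≈ 1#
  exp-0 = ⟶-unique (expSum⟶exp 0#) (boundedBy⇒⟶ {expSum 0#} {1#} λ 0<ε → 1 , λ n 1≤n →
      boundedBy-cong (sym (trans (+-congʳ (sum≈1 n 1≤n)) (-‿inverseʳ 1#))) refl
        (boundedBy-weaken (boundedBy-self ≤-refl) (<⇒≤ 0<ε)))
    where
    sum≈1 : ∀ n → 1 ℕ.≤ n → expSum 0# n ≈ 1#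
    sum≈1 (suc n) _ = trans (Σ-head n _) (trans (+-cong (expTerm-zero 0#)
      (trans (Σ-cong n (λ i _ → *-assoc 0# (0# ^ i) _)) (trans (Σ-*ˡ n 0# _) (zeroˡ _))))
      (+-identityʳ 1#))

  1+x≤exp : ∀ {x} → 0# ≤ x → 1# + x ≤ exp x
  1+x≤exp {x} 0≤x = ⟶-≤ (⟶-const _) (expSum⟶exp x) (2 , λ n 2≤n → begin
    1# + x                                        ≈⟨ +-cong (sym (trans (+-identityˡ _) (expTerm-zero x))) (sym first) ⟩
    expSum x 2                                    ≤⟨ Σ-monotone (expTerm-nonneg 0≤x) 2≤n ⟩
    expSum x n                                    ∎)
    where
    first : expTerm x 1 ≈ x
    first = begin-equality
      expTerm x 1              ≈⟨ solve 1 (λ t → t := (con (+ 1) :+ con (+ 0)) :* t) refl (expTerm x 1) ⟩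
      fromℕ 1 * expTerm x 1    ≈⟨ expTerm-suc x 0 ⟩
      x * expTerm x 0          ≈⟨ *-congˡ (expTerm-zero x) ⟩
      x * 1#                   ≈⟨ *-identityʳ x ⟩
      x                        ∎

  exp-*-neg : ∀ x → exp x * exp (- x) ≈ 1#
  exp-*-neg x = trans (sym (exp-+ x (- x))) (trans (exp-cong (-‿inverseʳ x)) exp-0)

  -- The series shows no sign at negative arguments, but exp x is the square of exp (x/2), and it is
  -- invertible by `exp-*-neg`.
  exp-pos : ∀ x → 0# < exp x
  exp-pos x = ≤-trans (0≤x² (exp (x /2))) (≤-reflexive (trans (sym (exp-+ _ _)) (exp-cong (x/2+x/2≈x x)))) ,
    λ 0≈exp → 0≉1 (trans (sym (zeroˡ _)) (trans (*-congʳ 0≈exp) (exp-*-neg x)))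

  exp-mono : ∀ {x y} → x ≤ y → exp x ≤ exp y
  exp-mono {x} {y} x≤y = begin
    exp x                 ≈⟨ sym (*-identityʳ _) ⟩
    exp x * 1#            ≤⟨ *-monoˡ (<⇒≤ (exp-pos x)) (≤-trans (x≤x+y 0≤d) (1+x≤exp 0≤d)) ⟩
    exp x * exp (y - x)   ≈⟨ sym (exp-+ _ _) ⟩
    exp (x + (y - x))     ≈⟨ exp-cong (solve 2 (λ x y → x :+ (y :- x) := y) refl x y) ⟩
    exp y                 ∎
    where 0≤d = 0≤y-x x≤y

  exp-cancel-≤ : ∀ {x y} → exp x ≤ exp y → x ≤ y
  exp-cancel-≤ {x} {y} ex≤ey = ≮⇒≥ λ y<x → <⇒≱ (begin-strict
    exp y                          <⟨ <-by (*-pos (exp-pos y) (0<y-x y<x))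
        (solve 3 (λ e x y → e :* (con (+ 1) :+ (x :- y)) := e :+ e :* (x :- y)) refl (exp y) x y) ⟩
    exp y * (1# + (x - y))         ≤⟨ *-monoˡ (<⇒≤ (exp-pos y)) (1+x≤exp (0≤y-x (<⇒≤ y<x))) ⟩
    exp y * exp (x - y)            ≈⟨ sym (exp-+ _ _) ⟩
    exp (y + (x - y))              ≈⟨ exp-cong (solve 2 (λ x y → y :+ (x :- y) := x) refl x y) ⟩
    exp x                          ∎) ex≤ey

  exp-fromℕ-* : ∀ n x → exp (fromℕ n * x) ≈ exp x ^ n
  exp-fromℕ-* zero    x = trans (exp-cong (zeroˡ x)) exp-0
  exp-fromℕ-* (suc n) x = begin-equality
    exp ((1# + fromℕ n) * x)        ≈⟨ exp-cong (trans (distribʳ x 1# _) (+-congʳ (*-identityˡ x))) ⟩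
    exp (x + fromℕ n * x)           ≈⟨ exp-+ _ _ ⟩
    exp x * exp (fromℕ n * x)       ≈⟨ *-congˡ (exp-fromℕ-* n x) ⟩
    exp x * exp x ^ n               ∎

  expTerm≤^ : ∀ {x} → 0# ≤ x → ∀ k → expTerm x k ≤ x ^ k
  expTerm≤^ {x} 0≤x k = begin
    expTerm x k                  ≈⟨ sym (*-identityˡ _) ⟩
    1# * expTerm x k             ≤⟨ *-monoʳ (expTerm-nonneg 0≤x k)
        (≤-trans (≤-reflexive (sym (+-identityʳ 1#))) (fromℕ-mono {1} (ℕ.1≤n! k))) ⟩
    fromℕ (k !) * expTerm x k    ≈⟨ k!*expTerm x k ⟩
    x ^ k                        ∎

  -- expSum x n ≤ ∑ xᵏ = (1 - xⁿ) / (1 - x)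
  expSum-geometric : ∀ {x} → 0# ≤ x → x ≤ 1# → ∀ n → expSum x n * (1# - x) + x ^ n ≤ 1#
  expSum-geometric {x} 0≤x x≤1 zero = ≤-reflexive (trans (+-congʳ (zeroˡ _)) (+-identityˡ 1#))
  expSum-geometric {x} 0≤x x≤1 (suc n) = begin
    (expSum x n + expTerm x n) * (1# - x) + x * x ^ n            ≈⟨
        solve 4 (λ s t x y → (s :+ t) :* (con (+ 1) :- x) :+ x :* y := s :* (con (+ 1) :- x) :+ x :* y :+ t :* (con (+ 1) :- x))
          refl (expSum x n) (expTerm x n) x (x ^ n) ⟩
    expSum x n * (1# - x) + x * x ^ n + expTerm x n * (1# - x)   ≤⟨ +-monoˡ _ (*-monoʳ (0≤y-x x≤1) (expTerm≤^ 0≤x n)) ⟩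
    expSum x n * (1# - x) + x * x ^ n + x ^ n * (1# - x)         ≈⟨
        solve 3 (λ s x y → s :* (con (+ 1) :- x) :+ x :* y :+ y :* (con (+ 1) :- x) := s :* (con (+ 1) :- x) :+ y)
          refl (expSum x n) x (x ^ n) ⟩
    expSum x n * (1# - x) + x ^ n                                ≤⟨ expSum-geometric 0≤x x≤1 n ⟩
    1#                                                           ∎

  -- The estimate `1+x≤exp` covers nonnegative arguments only. The negative ones come from exp x ≤
  -- 1/(1 - x), the comparison with the geometric series.
  1-x≤exp-neg : ∀ {x} → 0# ≤ x → x ≤ 1# → 1# - x ≤ exp (- x)
  1-x≤exp-neg {x} 0≤x x≤1 = *-cancelˡ-≤ (exp-pos x) (begin
    exp x * (1# - x)    ≤⟨ ⟶-≤ (⟶-* (expSum⟶exp x) (⟶-const (1# - x))) (⟶-const 1#)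
        (0 , λ n _ → ≤-trans (x≤x+y (^-nonneg n 0≤x)) (expSum-geometric 0≤x x≤1 n)) ⟩
    1#                  ≈⟨ sym (exp-*-neg x) ⟩
    exp x * exp (- x)   ∎)

  -- The value is the supremum `s` of all `y` with exp y ≤ x. Explicit shifts replace continuity. If
  -- exp s < x, put h = 1 - exp s / x: then exp s = (1 - h)x ≤ exp (- h) x, so s + h still belongs
  -- to the set. If x < exp s, put h = 1 - x / exp s: then x = (1 - h) exp s ≤ exp (s - h), so s - h
  -- is already an upper bound.
  exp-surjective : ∀ {x} → 1# ≤ x → ∃[ y ] (exp y ≈ x)
  exp-surjective {x} 1≤x = s , antisym (≮⇒≥ λ x<exp → too-large x<exp) (≮⇒≥ λ exp<x → too-small exp<x)
    where
    Below : Pred ℝ 0ℓ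
    Below y = exp y ≤ x

    0<x = <-≤-trans 0<1 1≤x

    below-x : IsUpperBound Below x
    below-x y exp≤x with total 0# y
    ... | inj₁ 0≤y = ≤-trans (≤-trans (≤-by 0≤1 (+-comm 1# y)) (1+x≤exp 0≤y)) exp≤x
    ... | inj₂ y≤0 = ≤-trans y≤0 (<⇒≤ 0<x)

    sup = complete Below (0# , ≤-trans (≤-reflexive exp-0) 1≤x) (x , below-x)
    s = proj₁ sup
    s-upper = proj₁ (proj₂ sup)
    s-least = proj₂ (proj₂ sup)

    too-small : ¬ (exp s < x)
    too-small exp<x = <⇒≱ (<-by 0<h refl) (s-upper (s + h) (*-cancelˡ-≤ (exp-pos (- h)) (begin
        exp (- h) * exp (s + h)   ≈⟨ sym (exp-+ _ _) ⟩
        exp (- h + (s + h))       ≈⟨ exp-cong (solve 2 (λ s h → :- h :+ (s :+ h) := s) refl s h) ⟩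
        exp s                     ≈⟨ solve 1 (λ e → e := e :* con (+ 1)) refl (exp s) ⟩
        exp s * 1#                ≈⟨ *-congˡ (sym (*-inverseʳ 0<x)) ⟩
        exp s * (x * x ⁻¹)        ≈⟨ solve 3 (λ e x i → e :* (x :* i) := (con (+ 1) :- (con (+ 1) :- e :* i)) :* x) refl (exp s) x (x ⁻¹) ⟩
        (1# - h) * x              ≤⟨ *-monoʳ (<⇒≤ 0<x) (1-x≤exp-neg (<⇒≤ 0<h) h≤1) ⟩
        exp (- h) * x             ∎)))
      where
      h = 1# - exp s * x ⁻¹

      0<h : 0# < h
      0<h = <-≤-trans (*-pos (0<y-x exp<x) (⁻¹-pos 0<x)) (≤-reflexive (trans
        (solve 3 (λ e x i → (x :- e) :* i := x :* i :- e :* i) refl (exp s) x (x ⁻¹)) (+-congʳ (*-inverseʳ 0<x))))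

      h≤1 : h ≤ 1#
      h≤1 = ≤-by (*-nonneg (<⇒≤ (exp-pos s)) (<⇒≤ (⁻¹-pos 0<x)))
        (solve 2 (λ e i → con (+ 1) := con (+ 1) :- e :* i :+ e :* i) refl (exp s) (x ⁻¹))

    too-large : ¬ (x < exp s)
    too-large x<exp = <⇒≱ (<-by 0<h (solve 2 (λ s h → s := s :- h :+ h) refl s h))
      (s-least (s - h) λ y exp≤x → exp-cancel-≤ (≤-trans exp≤x (begin
        x                          ≈⟨ sym (*-identityʳ x) ⟩
        x * 1#                     ≈⟨ *-congˡ (sym (*-inverseʳ (exp-pos s))) ⟩
        x * (exp s * exp s ⁻¹)     ≈⟨ solve 3 (λ e x i → x :* (e :* i) := e :* (con (+ 1) :- (con (+ 1) :- x :* i))) refl (exp s) x (exp s ⁻¹) ⟩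
        exp s * (1# - h)           ≤⟨ *-monoˡ (<⇒≤ (exp-pos s)) (1-x≤exp-neg (<⇒≤ 0<h) h≤1) ⟩
        exp s * exp (- h)          ≈⟨ sym (exp-+ _ _) ⟩
        exp (s - h)                ∎)))
      where
      h = 1# - x * exp s ⁻¹

      0<h : 0# < h
      0<h = <-≤-trans (*-pos (0<y-x x<exp) (⁻¹-pos (exp-pos s))) (≤-reflexive (trans
        (solve 3 (λ e x i → (e :- x) :* i := e :* i :- x :* i) refl (exp s) x (exp s ⁻¹)) (+-congʳ (*-inverseʳ (exp-pos s)))))

      h≤1 : h ≤ 1#
      h≤1 = ≤-by (*-nonneg (<⇒≤ 0<x) (<⇒≤ (⁻¹-pos (exp-pos s))))
        (solve 2 (λ e i → con (+ 1) := con (+ 1) :- e :* i :+ e :* i) refl x (exp s ⁻¹))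

  exp-ln : ∀ {x} → 1# ≤ x → exp (ln x) ≈ x
  exp-ln {x} 1≤x = the-satisfies {P = λ y → exp y ≈ x} (exp-surjective 1≤x)

  ln-⟶∞ : ∀ M → Eventually (λ n → M ≤ ln (fromℕ n))
  ln-⟶∞ M = suc K , λ n K<n → exp-cancel-≤ (begin
      exp M             ≤⟨ expM≤K ⟩
      fromℕ K           ≤⟨ fromℕ-mono (ℕ.<⇒≤ K<n) ⟩
      fromℕ n           ≈⟨ sym (exp-ln (≤-trans (≤-reflexive (sym (+-identityʳ 1#))) (fromℕ-mono {1} (ℕ.≤-trans (s≤s z≤n) K<n)))) ⟩
      exp (ln (fromℕ n)) ∎)
    where
    K = proj₁ (archimedean (exp M))

    expM≤K : exp M ≤ fromℕ K
    expM≤K = proj₂ (archimedean (exp M))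

-- Subset cardinalities and greedy domination

Nonempty⇒∣p∣>0 : ∀ {n} {p : Subset n} → Nonempty p → 1 ℕ.≤ ∣ p ∣
Nonempty⇒∣p∣>0 (x , x∈p) = ℕ.≤-trans (s≤s z≤n) (x∈p⇒∣p-x∣<∣p∣ x∈p)

∣p─q∣+∣q∩p∣≡∣p∣ : ∀ {n} (p q : Subset n) → ∣ p ─ q ∣ ℕ.+ ∣ q ∩ p ∣ ≡ ∣ p ∣
∣p─q∣+∣q∩p∣≡∣p∣ [] [] = ≡.refl
∣p─q∣+∣q∩p∣≡∣p∣ (outside ∷ p) (outside ∷ q) = ∣p─q∣+∣q∩p∣≡∣p∣ p q
∣p─q∣+∣q∩p∣≡∣p∣ (outside ∷ p) (inside ∷ q)  = ∣p─q∣+∣q∩p∣≡∣p∣ p q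
∣p─q∣+∣q∩p∣≡∣p∣ (inside ∷ p) (outside ∷ q)  = ≡.cong suc (∣p─q∣+∣q∩p∣≡∣p∣ p q)
∣p─q∣+∣q∩p∣≡∣p∣ (inside ∷ p) (inside ∷ q)   =
  ≡.trans (ℕ.+-suc _ _) (≡.cong suc (∣p─q∣+∣q∩p∣≡∣p∣ p q))

∣p∪q∣≤∣p∣+∣q∣ : ∀ {n} (p q : Subset n) → ∣ p ∪ q ∣ ℕ.≤ ∣ p ∣ ℕ.+ ∣ q ∣
∣p∪q∣≤∣p∣+∣q∣ [] [] = z≤n
∣p∪q∣≤∣p∣+∣q∣ (outside ∷ p) (outside ∷ q) = ∣p∪q∣≤∣p∣+∣q∣ p q
∣p∪q∣≤∣p∣+∣q∣ (outside ∷ p) (inside ∷ q)  =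
  ℕ.≤-trans (s≤s (∣p∪q∣≤∣p∣+∣q∣ p q)) (ℕ.≤-reflexive (≡.sym (ℕ.+-suc _ _)))
∣p∪q∣≤∣p∣+∣q∣ (inside ∷ p) (outside ∷ q)  = s≤s (∣p∪q∣≤∣p∣+∣q∣ p q)
∣p∪q∣≤∣p∣+∣q∣ (inside ∷ p) (inside ∷ q)   =
  s≤s (ℕ.≤-trans (∣p∪q∣≤∣p∣+∣q∣ p q) (ℕ.+-monoʳ-≤ ∣ p ∣ (ℕ.n≤1+n _)))

module _ {a b : ℕ} where

  column : BipartiteGraph a b → Fin b → Subset a
  column G w = Vec.map (λ row → lookup row w) G

  ∈column⇒∈N : ∀ G {v w} → v ∈ column G w → w ∈ N G v
  ∈column⇒∈N G {v} {w} v∈ = Vec.lookup⇒[]= w _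
    (≡.trans (≡.sym (Vec.lookup-map v _ G)) (Vec.[]=⇒lookup v∈))

  ∈N⇒∈column : ∀ G {v w} → w ∈ N G v → v ∈ column G w
  ∈N⇒∈column G {v} {w} w∈ = Vec.lookup⇒[]= v _
    (≡.trans (Vec.lookup-map v _ G) (Vec.[]=⇒lookup w∈))

  -- Relative to a set `U`, so that the greedy recursion can continue on the vertices not yet
  -- dominated.
  Dominates : BipartiteGraph a b → Subset b → Subset a → Set
  Dominates G D U = ∀ v → v ∈ U → ∃[ w ] (w ∈ N G v × w ∈ D)

  Dominates-∪ : ∀ G w {D U} → Dominates G D (U ─ column G w) → Dominates G (⁅ w ⁆ ∪ D) U
  Dominates-∪ G w {D} {U} dom v v∈U with v ∈? column G w
  ... | yes v∈w = w , ∈column⇒∈N G v∈w , x∈p∪q⁺ (inj₁ (x∈⁅x⁆ w))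
  ... | no v∉w = let w′ , w′∈N , w′∈D = dom v (x∈p∧x∉q⇒x∈p─q v∈U v∉w) in w′ , w′∈N , x∈p∪q⁺ (inj₂ w′∈D)

  -- Cap t r: a set of r vertices can be dominated greedily in t steps.
  greedyDomination : (G : BipartiteGraph a b) (s : ℕ → ℕ) (Cap : ℕ → ℕ → Set) →
    (∀ r → Cap 0 r → r ≡ 0) →
    (∀ t r d → 1 ℕ.≤ r → s r ℕ.≤ d → d ℕ.≤ r → Cap (suc t) r → Cap t (r ℕ.∸ d)) →
    (∀ U → Nonempty U → ∃[ w ] (s ∣ U ∣ ℕ.≤ ∣ column G w ∩ U ∣)) →
    ∀ t U → Cap t ∣ U ∣ → ∃[ D ] (∣ D ∣ ℕ.≤ t × Dominates G D U)
  greedyDomination G s Cap cap-zero cap-suc rich = go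
    where
    go : ∀ t U → Cap t ∣ U ∣ → ∃[ D ] (∣ D ∣ ℕ.≤ t × Dominates G D U)
    go t U cap with nonempty? U
    ... | no empty = ⊥ , ℕ.≤-trans (ℕ.≤-reflexive (∣⊥∣≡0 b)) z≤n , λ v v∈U → contradiction (v , v∈U) empty
    go zero U cap | yes nonempty =
      contradiction (Nonempty⇒∣p∣>0 nonempty) (ℕ.<⇒≱ (s≤s (ℕ.≤-reflexive (cap-zero _ cap))))
    go (suc t) U cap | yes nonempty =
      let w , s≤d = rich U nonempty
          -- The new size depends on the old one and on the number of vertices hit, so `Cap` has to
          -- speak of sizes only.
          ∣U─w∣≡ = ≡.trans (≡.sym (ℕ.m+n∸n≡m ∣ U ─ column G w ∣ ∣ column G w ∩ U ∣))
                     (≡.cong (ℕ._∸ ∣ column G w ∩ U ∣) (∣p─q∣+∣q∩p∣≡∣p∣ U (column G w)))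
          D , ∣D∣≤t , dom = go t (U ─ column G w) (≡.subst (Cap t) (≡.sym ∣U─w∣≡)
            (cap-suc t ∣ U ∣ _ (Nonempty⇒∣p∣>0 nonempty) s≤d (∣p∩q∣≤∣q∣ (column G w) U) cap))
      in ⁅ w ⁆ ∪ D ,
         ℕ.≤-trans (∣p∪q∣≤∣p∣+∣q∣ ⁅ w ⁆ D)
           (ℕ.≤-trans (ℕ.≤-reflexive (≡.cong (ℕ._+ ∣ D ∣) (∣⁅x⁆∣≡1 w))) (s≤s ∣D∣≤t)) ,
         Dominates-∪ G w dom

column-zero : ∀ {a b} (c : Subset a) (G : BipartiteGraph a b) → column (zipWith _∷_ c G) zero ≡ c
column-zero []      []      = ≡.refl
column-zero (x ∷ c) (r ∷ G) = ≡.cong (x ∷_) (column-zero c G)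

column-suc : ∀ {a b} (c : Subset a) (G : BipartiteGraph a b) w →
             column (zipWith _∷_ c G) (suc w) ≡ column G w
column-suc []      []      w = ≡.refl
column-suc (x ∷ c) (r ∷ G) w = ≡.cong (lookup r w ∷_) (column-suc c G w)

-- Expectations and the measure of the random bipartite graph

module Expectations (em : ExcludedMiddle 0ℓ) (R : CompleteOrderedField) where
  open RealAnalysis em R
  open OrderedField em R
  open import Algebra.Properties.CommutativeMonoid.Sum (CompleteOrderedField.*-commutativeMonoid R)
    using () renaming (sum to product)

  𝟙 : Set → ℝ
  𝟙 P = if does (em {P}) then 1# else 0#

  𝟙-yes : ∀ {P} → P → 𝟙 P ≈ 1#
  𝟙-yes {P} p with em {P}
  ... | yes _ = refl
  ... | no ¬p = contradiction p ¬p

  𝟙-no : ∀ {P} → ¬ P → 𝟙 P ≈ 0#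
  𝟙-no {P} ¬p with em {P}
  ... | yes p = contradiction p ¬p
  ... | no _  = refl

  𝟙-nonneg : ∀ P → 0# ≤ 𝟙 P
  𝟙-nonneg P with em {P}
  ... | yes _ = 0≤1
  ... | no _  = ≤-refl

  𝟙-mono : ∀ {P Q} → (P → Q) → 𝟙 P ≤ 𝟙 Q
  𝟙-mono {P} {Q} P⇒Q with em {P}
  ... | yes p = ≤-reflexive (sym (𝟙-yes (P⇒Q p)))
  ... | no _  = 𝟙-nonneg Q

  𝟙-cong : ∀ {P Q} → (P → Q) → (Q → P) → 𝟙 P ≈ 𝟙 Q
  𝟙-cong P⇒Q Q⇒P = antisym (𝟙-mono P⇒Q) (𝟙-mono Q⇒P)

  𝟙-× : ∀ P Q → 𝟙 (P × Q) ≈ 𝟙 P * 𝟙 Q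
  𝟙-× P Q with em {P}
  ... | yes p = trans (𝟙-cong proj₂ (p ,_)) (sym (*-identityˡ _))
  ... | no ¬p = trans (𝟙-no (λ (p , _) → ¬p p)) (sym (zeroˡ _))

  𝟙-∀-suc : ∀ {n} (P : Fin (suc n) → Set) → 𝟙 (∀ i → P i) ≈ 𝟙 (P zero) * 𝟙 (∀ i → P (suc i))
  𝟙-∀-suc P = trans (𝟙-cong (λ p → p zero , λ i → p (suc i)) (λ { (p , q) zero → p ; (p , q) (suc i) → q i }))
    (𝟙-× _ _)

  Functional : Set → Set
  Functional X = (X → ℝ) → ℝ

  -- A probability measure seen as a monotone, normalised linear functional. These laws are all that
  -- the union bound, Fubini and the independence arguments use.
  record IsExpectation {X : Set} (E : Functional X) : Set where
    field
      mono    : ∀ {F G} → (∀ x → F x ≤ G x) → E F ≤ E G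
      +-homo  : ∀ F G → E (λ x → F x + G x) ≈ E F + E G
      *-homo  : ∀ c F → E (λ x → c * F x) ≈ c * E F
      E-1     : E (λ _ → 1#) ≈ 1#

    cong : ∀ {F G} → (∀ x → F x ≈ G x) → E F ≈ E G
    cong F≈G = antisym (mono (λ x → ≤-reflexive (F≈G x))) (mono (λ x → ≤-reflexive (sym (F≈G x))))

    E-const : ∀ c → E (λ _ → c) ≈ c
    E-const c = trans (cong (λ _ → sym (*-identityʳ c)))
      (trans (*-homo c (λ _ → 1#)) (trans (*-congˡ E-1) (*-identityʳ c)))

    E-nonneg : ∀ {F} → (∀ x → 0# ≤ F x) → 0# ≤ E F
    E-nonneg 0≤F = ≤-trans (≤-reflexive (sym (E-const 0#))) (mono 0≤F)

  -- The product measure as an iterated expectation; independence of the coordinates is built in and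
  -- becomes a power in `𝔼Vec-∀`.
  𝔼Vec : ∀ {X : Set} → Functional X → ∀ n → Functional (Vec X n)
  𝔼Vec E zero    F = F []
  𝔼Vec E (suc n) F = E (λ x → 𝔼Vec E n (λ xs → F (x ∷ xs)))

  𝔼Vec-isExpectation : ∀ {X} {E : Functional X} → IsExpectation E → ∀ n → IsExpectation (𝔼Vec E n)
  𝔼Vec-isExpectation isE zero = record
    { mono = λ F≤G → F≤G [] ; +-homo = λ _ _ → refl ; *-homo = λ _ _ → refl ; E-1 = refl }
  𝔼Vec-isExpectation {E = E} isE (suc n) = record
    { mono   = λ F≤G → E.mono (λ x → En.mono (λ xs → F≤G (x ∷ xs)))
    ; +-homo = λ F G → trans (E.cong (λ x → En.+-homo _ _)) (E.+-homo _ _)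
    ; *-homo = λ c F → trans (E.cong (λ x → En.*-homo c _)) (E.*-homo c _)
    ; E-1    = trans (E.cong (λ _ → En.E-1)) E.E-1
    }
    where
    module E = IsExpectation isE
    module En = IsExpectation (𝔼Vec-isExpectation isE n)

  𝔼Vec-cong : ∀ {X} {E E′ : Functional X} → IsExpectation E′ → (∀ F → E F ≈ E′ F) →
              ∀ n F → 𝔼Vec E n F ≈ 𝔼Vec E′ n F
  𝔼Vec-cong isE′ E≈E′ zero    F = refl
  𝔼Vec-cong isE′ E≈E′ (suc n) F = trans (E≈E′ _)
    (IsExpectation.cong isE′ (λ x → 𝔼Vec-cong isE′ E≈E′ n _))

  𝔼Vec-∀ : ∀ {X} {E : Functional X} → IsExpectation E → ∀ n (P : Pred X 0ℓ) →
           𝔼Vec E n (λ xs → 𝟙 (∀ i → P (lookup xs i))) ≈ E (λ x → 𝟙 (P x)) ^ n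
  𝔼Vec-∀ isE zero    P = 𝟙-yes (λ ())
  𝔼Vec-∀ {E = E} isE (suc n) P = begin-equality
    E (λ x → 𝔼Vec E n (λ xs → 𝟙 (∀ i → P (lookup (x ∷ xs) i))))              ≈⟨ E.cong (λ x → En.cong (λ xs → 𝟙-∀-suc (λ i → P (lookup (x ∷ xs) i)))) ⟩
    E (λ x → 𝔼Vec E n (λ xs → 𝟙 (P x) * 𝟙 (∀ i → P (lookup xs i))))          ≈⟨ E.cong (λ x → En.*-homo _ _) ⟩
    E (λ x → 𝟙 (P x) * 𝔼Vec E n (λ xs → 𝟙 (∀ i → P (lookup xs i))))          ≈⟨ E.cong (λ x → trans (*-congˡ (𝔼Vec-∀ isE n P)) (*-comm _ _)) ⟩
    E (λ x → E (λ x → 𝟙 (P x)) ^ n * 𝟙 (P x))                                ≈⟨ E.*-homo _ _ ⟩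
    E (λ x → 𝟙 (P x)) ^ n * E (λ x → 𝟙 (P x))                                ≈⟨ *-comm _ _ ⟩
    E (λ x → 𝟙 (P x)) * E (λ x → 𝟙 (P x)) ^ n                                ∎
    where
    module E = IsExpectation isE
    module En = IsExpectation (𝔼Vec-isExpectation isE n)

  sumOver : ∀ {X : Set} → List X → Functional X
  sumOver xs F = foldr _+_ 0# (map F xs)

  sumOver-cong : ∀ {X : Set} (xs : List X) {F G} → (∀ x → F x ≈ G x) → sumOver xs F ≈ sumOver xs G
  sumOver-cong []       F≈G = refl
  sumOver-cong (x ∷ xs) F≈G = +-cong (F≈G x) (sumOver-cong xs F≈G)

  sumOver-mono : ∀ {X : Set} (xs : List X) {F G} → (∀ x → F x ≤ G x) → sumOver xs F ≤ sumOver xs G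
  sumOver-mono []       F≤G = ≤-refl
  sumOver-mono (x ∷ xs) F≤G = +-mono (F≤G x) (sumOver-mono xs F≤G)

  sumOver-* : ∀ {X : Set} (xs : List X) c F → sumOver xs (λ x → c * F x) ≈ c * sumOver xs F
  sumOver-* []       c F = sym (zeroʳ c)
  sumOver-* (x ∷ xs) c F = trans (+-congˡ (sumOver-* xs c F)) (sym (distribˡ c _ _))

  sumOver-++ : ∀ {X : Set} (xs ys : List X) F → sumOver (xs ++ ys) F ≈ sumOver xs F + sumOver ys F
  sumOver-++ []       ys F = sym (+-identityˡ _)
  sumOver-++ (x ∷ xs) ys F = trans (+-congˡ (sumOver-++ xs ys F)) (sym (+-assoc _ _ _))

  sumOver-map : ∀ {X Y : Set} (f : X → Y) (xs : List X) F → sumOver (map f xs) F ≈ sumOver xs (λ x → F (f x))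
  sumOver-map f []       F = refl
  sumOver-map f (x ∷ xs) F = +-congˡ (sumOver-map f xs F)

  sumOver-cartesianProductWith : ∀ {X Y Z : Set} (f : X → Y → Z) (xs : List X) (ys : List Y) F →
    sumOver (cartesianProductWith f xs ys) F ≈ sumOver xs (λ x → sumOver ys (λ y → F (f x y)))
  sumOver-cartesianProductWith f []       ys F = refl
  sumOver-cartesianProductWith f (x ∷ xs) ys F = trans
    (sumOver-++ (map (f x) ys) (cartesianProductWith f xs ys) F)
    (+-cong (sumOver-map (f x) ys F) (sumOver-cartesianProductWith f xs ys F))

  E-sumOver : ∀ {X Y : Set} {E : Functional X} → IsExpectation E → (ys : List Y) (F : Y → X → ℝ) →
              E (λ x → sumOver ys (λ y → F y x)) ≈ sumOver ys (λ y → E (F y))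
  E-sumOver isE []       F = IsExpectation.E-const isE 0#
  E-sumOver isE (y ∷ ys) F = trans (IsExpectation.+-homo isE _ _) (+-congˡ (E-sumOver isE ys F))

  -- The bridge from a finite sum with product weights to an iterated expectation: the weight of the
  -- head factors out of the sum over the tails.
  sumOver-allVecs : ∀ {X : Set} (xs : List X) (φ : X → ℝ) n F →
    sumOver (allVecs xs n) (λ v → product {n} (λ i → φ (lookup v i)) * F v) ≈
    𝔼Vec (λ G → sumOver xs (λ x → φ x * G x)) n F
  sumOver-allVecs xs φ zero    F = trans (+-identityʳ _) (*-identityˡ _)
  sumOver-allVecs xs φ (suc n) F = trans
    (sumOver-cartesianProductWith _∷_ xs (allVecs xs n) _)
    (sumOver-cong xs λ x → trans
      (trans (sumOver-cong (allVecs xs n) (λ v → *-assoc _ _ _)) (sumOver-* (allVecs xs n) (φ x) _))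
      (*-congˡ (sumOver-allVecs xs φ n _)))

  sumOver-subsets-const : ∀ n c → sumOver (allVecs (inside ∷ outside ∷ []) n) (λ _ → c) ≈ fromℕ 2 ^ n * c
  sumOver-subsets-const zero    c = trans (+-identityʳ c) (sym (*-identityˡ c))
  sumOver-subsets-const (suc n) c = trans
    (sumOver-cartesianProductWith _∷_ (inside ∷ outside ∷ []) (allVecs (inside ∷ outside ∷ []) n) _)
    (trans (+-cong (sumOver-subsets-const n c) (+-congʳ (sumOver-subsets-const n c)))
      (solve 2 (λ x c → x :* c :+ (x :* c :+ con (+ 0)) := con (+ 2) :* x :* c) refl (fromℕ 2 ^ n) c))

  -- Used for the union bound: one term is at most the whole sum. Recursion along `U` picks the half
  -- of the enumeration that contains it.
  sumOver-subsets-≤ : ∀ {n} (F : Subset n → ℝ) → (∀ U → 0# ≤ F U) → ∀ U →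
                      F U ≤ sumOver (allVecs (inside ∷ outside ∷ []) n) F
  sumOver-subsets-≤ F 0≤F []            = ≤-reflexive (sym (+-identityʳ _))
  sumOver-subsets-≤ {suc n} F 0≤F (x ∷ U) = ≤-trans (either x) (≤-reflexive
      (sym (sumOver-cartesianProductWith _∷_ (inside ∷ outside ∷ []) (allVecs (inside ∷ outside ∷ []) n) F)))
    where
    subsets = allVecs (inside ∷ outside ∷ []) n

    sum-nonneg : ∀ x → 0# ≤ sumOver subsets (λ V → F (x ∷ V))
    sum-nonneg x = ≤-trans (0≤F (x ∷ U)) (sumOver-subsets-≤ (λ V → F (x ∷ V)) (λ V → 0≤F (x ∷ V)) U)

    either : ∀ x → F (x ∷ U) ≤ sumOver subsets (λ V → F (inside ∷ V)) + (sumOver subsets (λ V → F (outside ∷ V)) + 0#)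
    either inside  = ≤-trans (sumOver-subsets-≤ (λ V → F (inside ∷ V)) (λ V → 0≤F (inside ∷ V)) U)
      (x≤x+y (≤-trans (sum-nonneg outside) (≤-reflexive (sym (+-identityʳ _)))))
    either outside = ≤-trans (sumOver-subsets-≤ (λ V → F (outside ∷ V)) (λ V → 0≤F (outside ∷ V)) U)
      (≤-by (sum-nonneg inside) (solve 2 (λ x y → x :+ (y :+ con (+ 0)) := y :+ x) refl _ _))

  module Bernoulli (p : ℝ) (0≤p : 0# ≤ p) (p≤1 : p ≤ 1#) where

    0≤1-p : 0# ≤ 1# - p
    0≤1-p = 0≤y-x p≤1

    𝔼Bool : Functional Bool
    𝔼Bool F = p * F true + (1# - p) * F false

    𝔼Bool-isExpectation : IsExpectation 𝔼Bool
    𝔼Bool-isExpectation = record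
      { mono   = λ F≤G → +-mono (*-monoˡ 0≤p (F≤G true)) (*-monoˡ 0≤1-p (F≤G false))
      ; +-homo = λ F G → solve 5 (λ p a b c d → p :* (a :+ b) :+ (con (+ 1) :- p) :* (c :+ d) :=
                   (p :* a :+ (con (+ 1) :- p) :* c) :+ (p :* b :+ (con (+ 1) :- p) :* d)) refl p (F true) (G true) (F false) (G false)
      ; *-homo = λ c F → solve 4 (λ p c a b → p :* (c :* a) :+ (con (+ 1) :- p) :* (c :* b) :=
                   c :* (p :* a :+ (con (+ 1) :- p) :* b)) refl p c (F true) (F false)
      ; E-1    = solve 1 (λ p → p :* con (+ 1) :+ (con (+ 1) :- p) :* con (+ 1) := con (+ 1)) refl p
      }

    𝔼Subset : ∀ n → Functional (Subset n)
    𝔼Subset = 𝔼Vec 𝔼Bool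

    𝔼Graph : ∀ a b → Functional (BipartiteGraph a b)
    𝔼Graph a b = 𝔼Vec (𝔼Subset b) a

    𝔼Subset-isExpectation : ∀ n → IsExpectation (𝔼Subset n)
    𝔼Subset-isExpectation = 𝔼Vec-isExpectation 𝔼Bool-isExpectation

    𝔼Graph-isExpectation : ∀ a b → IsExpectation (𝔼Graph a b)
    𝔼Graph-isExpectation a b = 𝔼Vec-isExpectation (𝔼Subset-isExpectation b) a

    -- `sumOver-allVecs` is applied twice, to the rows of the graph and to the entries of a row.
    ℙ≈𝔼 : ∀ a b (P : Pred (BipartiteGraph a b) 0ℓ) →
          RandomBipartiteGraph.ℙ[_] a b p P ≈ 𝔼Graph a b (λ G → 𝟙 (P G))
    ℙ≈𝔼 a b P = trans (sumOver-allVecs (allVecs (inside ∷ outside ∷ []) b) _ a _)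
      (𝔼Vec-cong (𝔼Subset-isExpectation b)
        (λ F → trans (sumOver-allVecs (inside ∷ outside ∷ []) (λ x → if x then p else 1# - p) b F)
          (𝔼Vec-cong 𝔼Bool-isExpectation (λ F → +-congˡ (+-identityʳ _)) b F)) a _)

    fubini-Bool : ∀ {X} {E : Functional X} → IsExpectation E → (F : X → Bool → ℝ) →
                  E (λ x → 𝔼Bool (F x)) ≈ 𝔼Bool (λ s → E (λ x → F x s))
    fubini-Bool isE F = trans (IsExpectation.+-homo isE _ _)
      (+-cong (IsExpectation.*-homo isE p _) (IsExpectation.*-homo isE (1# - p) _))

    -- One coin is a combination of two values, so exchanging it with `E` is linearity of `E`; more
    -- coins follow by induction.
    fubini : ∀ {X} {E : Functional X} → IsExpectation E → ∀ n (F : X → Subset n → ℝ) →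
             E (λ x → 𝔼Subset n (F x)) ≈ 𝔼Subset n (λ U → E (λ x → F x U))
    fubini isE zero    F = refl
    fubini isE (suc n) F = trans
      (fubini-Bool isE (λ x s → 𝔼Subset n (λ U → F x (s ∷ U))))
      (IsExpectation.cong 𝔼Bool-isExpectation (λ s → fubini isE n (λ x U → F x (s ∷ U))))

    -- The measure is built row by row, that is by neighbourhoods of vertices of A, while the main
    -- estimate concerns neighbourhoods of vertices of B. Fubini lets the first column be drawn
    -- before the rest.
    𝔼Graph-column : ∀ a b F → 𝔼Graph a (suc b) F ≈ 𝔼Subset a (λ c → 𝔼Graph a b (λ G → F (zipWith _∷_ c G)))
    𝔼Graph-column zero    b F = refl
    𝔼Graph-column (suc a) b F = Bit.cong λ s → trans
      (Row.cong (λ r → 𝔼Graph-column a b (λ G → F ((s ∷ r) ∷ G))))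
      (fubini (𝔼Subset-isExpectation b) a _)
      where
      module Bit = IsExpectation 𝔼Bool-isExpectation
      module Row = IsExpectation (𝔼Subset-isExpectation b)

    𝔼Graph-∀-column : ∀ a b (P : Pred (Subset a) 0ℓ) →
      𝔼Graph a b (λ G → 𝟙 (∀ w → P (column G w))) ≈ 𝔼Subset a (λ c → 𝟙 (P c)) ^ b
    𝔼Graph-∀-column a zero P = trans (Graph.cong (λ G → 𝟙-yes (λ ()))) Graph.E-1
      where module Graph = IsExpectation (𝔼Graph-isExpectation a zero)
    𝔼Graph-∀-column a (suc b) P = begin-equality
      𝔼Graph a (suc b) (λ G → 𝟙 (∀ w → P (column G w)))                                  ≈⟨ 𝔼Graph-column a b _ ⟩
      𝔼Subset a (λ c → 𝔼Graph a b (λ G → 𝟙 (∀ w → P (column (zipWith _∷_ c G) w))))      ≈⟨ Col.cong (λ c → Graph.cong (λ G → trans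
          (𝟙-∀-suc (λ w → P (column (zipWith _∷_ c G) w))) (*-cong (𝟙-subst (column-zero c G)) (𝟙-∀-cong (λ w → column-suc c G w))))) ⟩
      𝔼Subset a (λ c → 𝔼Graph a b (λ G → 𝟙 (P c) * 𝟙 (∀ w → P (column G w))))            ≈⟨ Col.cong (λ c → trans (Graph.*-homo _ _)
          (trans (*-congˡ (𝔼Graph-∀-column a b P)) (*-comm _ _))) ⟩
      𝔼Subset a (λ c → 𝔼Subset a (λ c → 𝟙 (P c)) ^ b * 𝟙 (P c))                          ≈⟨ Col.*-homo _ _ ⟩
      𝔼Subset a (λ c → 𝟙 (P c)) ^ b * 𝔼Subset a (λ c → 𝟙 (P c))                          ≈⟨ *-comm _ _ ⟩
      𝔼Subset a (λ c → 𝟙 (P c)) ^ suc b                                                  ∎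
      where
      module Graph = IsExpectation (𝔼Graph-isExpectation a b)
      module Col = IsExpectation (𝔼Subset-isExpectation a)

      𝟙-subst : ∀ {c c′} → c ≡ c′ → 𝟙 (P c) ≈ 𝟙 (P c′)
      𝟙-subst ≡.refl = refl

      𝟙-∀-cong : ∀ {C C′ : Fin b → Subset a} → (∀ w → C w ≡ C′ w) → 𝟙 (∀ w → P (C w)) ≈ 𝟙 (∀ w → P (C′ w))
      𝟙-∀-cong C≡C′ = 𝟙-cong (λ h w → ≡.subst P (C≡C′ w) (h w)) (λ h w → ≡.subst P (≡.sym (C≡C′ w)) (h w))

    ℙ-Nonempty : ∀ n → 𝔼Subset n (λ U → 𝟙 (Nonempty U)) ≈ 1# - (1# - p) ^ n
    ℙ-Nonempty zero = trans (𝟙-no (λ ())) (sym (-‿inverseʳ 1#))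
    ℙ-Nonempty (suc n) = trans (+-cong
        (*-congˡ (trans (Un.cong (λ U → 𝟙-yes (zero , here))) Un.E-1))
        (*-congˡ (trans (Un.cong (λ U → 𝟙-cong (λ { (suc i , there i∈U) → i , i∈U }) (λ { (i , i∈U) → suc i , there i∈U }))) (ℙ-Nonempty n))))
      (solve 2 (λ p x → p :* con (+ 1) :+ (con (+ 1) :- p) :* (con (+ 1) :- x) := con (+ 1) :- (con (+ 1) :- p) :* x) refl p ((1# - p) ^ n))
      where module Un = IsExpectation (𝔼Subset-isExpectation n)

    ℙ-∣c∩U∣> : ∀ {n} → Subset n → ℕ → ℝ
    ℙ-∣c∩U∣> {n} U s = 𝔼Subset n (λ c → 𝟙 (s ℕ.< ∣ c ∩ U ∣))

    ℙ-∣c∩U∣>-nonneg : ∀ {n} (U : Subset n) s → 0# ≤ ℙ-∣c∩U∣> U s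
    ℙ-∣c∩U∣>-nonneg {n} U s = IsExpectation.E-nonneg (𝔼Subset-isExpectation n) (λ c → 𝟙-nonneg _)

    -- U contains s disjoint groups of m elements and one of k elements; a group
    -- of j ≤ m elements is hit with probability 1 - (1 - p)ʲ ≥ jq.
    module _ (m : ℕ) (q : ℝ) (0≤q : 0# ≤ q) (q[1+pm]≤p : q * (1# + p * fromℕ m) ≤ p) where

      ℙ-∣c∩U∣>-groups : ∀ {n} (U : Subset n) s k → k ℕ.≤ m → k ℕ.+ s ℕ.* m ℕ.≤ ∣ U ∣ →
        fromℕ k * q * (fromℕ m * q) ^ s ≤ ℙ-∣c∩U∣> U s
      ℙ-∣c∩U∣>-groups U s zero k≤m h = ≤-trans (≤-reflexive (trans (*-congʳ (zeroˡ q)) (zeroˡ _))) (ℙ-∣c∩U∣>-nonneg U s)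
      ℙ-∣c∩U∣>-groups (outside ∷ U) s (suc k) k≤m h = ≤-trans (ℙ-∣c∩U∣>-groups U s (suc k) k≤m h)
        (≤-reflexive (solve 2 (λ p x → x := p :* x :+ (con (+ 1) :- p) :* x) refl p (ℙ-∣c∩U∣> U s)))
      ℙ-∣c∩U∣>-groups {suc n} (inside ∷ U) s (suc k) k<m (s≤s h) = begin
        fromℕ (suc k) * q * X                                       ≤⟨ *-monoʳ 0≤X [1+k]q≤ ⟩
        (p + (1# - p) * (fromℕ k * q)) * X                          ≈⟨ solve 3 (λ p kq x → (p :+ (con (+ 1) :- p) :* kq) :* x := p :* x :+ (con (+ 1) :- p) :* (kq :* x)) refl p (fromℕ k * q) X ⟩
        p * X + (1# - p) * (fromℕ k * q * X)                        ≤⟨ +-mono (*-monoˡ 0≤p (hit s h)) (*-monoˡ 0≤1-p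
            (ℙ-∣c∩U∣>-groups U s k (ℕ.<⇒≤ k<m) h)) ⟩
        ℙ-∣c∩U∣> (inside ∷ U) s                                     ∎
        where
        X = (fromℕ m * q) ^ s
        0≤X = ^-nonneg s (*-nonneg (fromℕ-nonneg m) 0≤q)

        -- Because k ≤ m, p ≥ q(1 + pm) ≥ q(1 + pk), which is the claim rearranged.
        [1+k]q≤ : fromℕ (suc k) * q ≤ p + (1# - p) * (fromℕ k * q)
        [1+k]q≤ = ≤-by (+-nonneg (0≤y-x q[1+pm]≤p) (*-nonneg (*-nonneg 0≤q 0≤p) (0≤y-x (fromℕ-mono (ℕ.<⇒≤ k<m)))))
          (solve 4 (λ p q k m → p :+ (con (+ 1) :- p) :* (k :* q) :=
            (con (+ 1) :+ k) :* q :+ ((p :- q :* (con (+ 1) :+ p :* m)) :+ q :* p :* (m :- k))) refl p q (fromℕ k) (fromℕ m))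

        -- After a hit the rest of the current group is dropped and one of the `s` full groups
        -- becomes the current one. With no full group left, this hit already completes the count.
        hit : ∀ s → k ℕ.+ s ℕ.* m ℕ.≤ ∣ U ∣ → (fromℕ m * q) ^ s ≤ 𝔼Subset n (λ c → 𝟙 (s ℕ.< suc ∣ c ∩ U ∣))
        hit zero h = ≤-reflexive (sym (trans (Un.cong (λ c → 𝟙-yes (s≤s z≤n))) Un.E-1))
          where module Un = IsExpectation (𝔼Subset-isExpectation n)
        hit (suc s) h = ≤-trans (ℙ-∣c∩U∣>-groups U s m ℕ.≤-refl (ℕ.≤-trans (ℕ.m≤n+m _ k) h))
          (Un.mono (λ c → 𝟙-mono s≤s))
          where module Un = IsExpectation (𝔼Subset-isExpectation n)

-- The threshold and the number of greedy steps

module Threshold (em : ExcludedMiddle 0ℓ) (R : CompleteOrderedField) where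
  open RealAnalysis em R
  open OrderedField em R

  module _ (κ : ℝ) (0<κ : 0# < κ) where

    abstract
      -- ⌈√(κr)⌉
      threshold-spec : ∀ r → ∃[ s ] (κ * fromℕ r ≤ fromℕ s * fromℕ s ×
                                     (∀ s′ → κ * fromℕ r ≤ fromℕ s′ * fromℕ s′ → s ℕ.≤ s′))
      threshold-spec r = leastNatural _ (suc K) (begin
          κ * fromℕ r                      ≤⟨ κr≤K ⟩
          fromℕ K                          ≤⟨ ≤-by (+-nonneg (+-nonneg 0≤1 0≤K) (*-nonneg 0≤K 0≤K))
              (solve 1 (λ k → (con (+ 1) :+ k) :* (con (+ 1) :+ k) := k :+ (con (+ 1) :+ k :+ k :* k)) refl (fromℕ K)) ⟩
          fromℕ (suc K) * fromℕ (suc K)    ∎)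
        where
        K : ℕ
        K = proj₁ (archimedean (κ * fromℕ r))

        0≤K : 0# ≤ fromℕ K
        0≤K = fromℕ-nonneg K

        κr≤K : κ * fromℕ r ≤ fromℕ K
        κr≤K = proj₂ (archimedean (κ * fromℕ r))

    threshold : ℕ → ℕ
    threshold r = proj₁ (threshold-spec r)

    κr≤threshold² : ∀ r → κ * fromℕ r ≤ fromℕ (threshold r) * fromℕ (threshold r)
    κr≤threshold² r = proj₁ (proj₂ (threshold-spec r))

    threshold-1<κr : ∀ r {s} → threshold r ≡ suc s → fromℕ s * fromℕ s < κ * fromℕ r
    threshold-1<κr r {s} eq = ≰⇒> λ κr≤s² →
      ℕ.1+n≰n (≡.subst (ℕ._≤ s) eq (proj₂ (proj₂ (threshold-spec r)) s κr≤s²))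

    -- Removing √(κr) of r vertices lowers √r by at least √κ/2, which suggests 4r ≤ κt². The
    -- constant 9 = 3² gives room for the induction on integers: with c² in its place, a step needs
    -- (t + 1)² - t² = 2t + 1 ≤ ct for all t ≥ 1, so c = 3.
    WithinReach : ℕ → ℕ → Set
    WithinReach t r = fromℕ 9 * fromℕ r ≤ κ * (fromℕ t * fromℕ t)

    WithinReach-zero : ∀ r → WithinReach 0 r → r ≡ 0
    WithinReach-zero r 9r≤0 = ℕ.n≤0⇒n≡0 (fromℕ-cancel-≤ (*-cancelˡ-≤ (fromℕ-pos 8)
      (≤-trans 9r≤0 (≤-reflexive (solve 1 (λ k → k :* (con (+ 0) :* con (+ 0)) := con (+ 9) :* con (+ 0)) refl κ)))))

    -- If 9r > κt², then s ≥ √(κr) ≥ κt/3 ≥ κ((t + 1)² - t²)/9 for t ≥ 1.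
    WithinReach-suc : ∀ t r d → 1 ℕ.≤ r → threshold r ℕ.≤ d → d ℕ.≤ r →
                      WithinReach (suc t) r → WithinReach t (r ℕ.∸ d)
    WithinReach-suc t r d 1≤r s≤d d≤r 9r≤κ[1+t]² =
      [ (λ 9r≤κt² → ≤-trans (*-monoˡ (fromℕ-nonneg 9) (fromℕ-mono (ℕ.m∸n≤m r d))) 9r≤κt²)
      , go t 9r≤κ[1+t]²
      ]′ (total (fromℕ 9 * fromℕ r) (κ * (fromℕ t * fromℕ t)))
      where
      κr≤d² : κ * fromℕ r ≤ fromℕ d * fromℕ d
      κr≤d² = ≤-trans (κr≤threshold² r)
        (*-mono 0≤s 0≤s (fromℕ-mono s≤d) (fromℕ-mono s≤d))
        where 0≤s = fromℕ-nonneg (threshold r)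

      go : ∀ t → WithinReach (suc t) r → κ * (fromℕ t * fromℕ t) ≤ fromℕ 9 * fromℕ r → WithinReach t (r ℕ.∸ d)
      -- Only one step is left: r ≤ κ gives r² ≤ κr ≤ d², so this step removes every remaining
      -- vertex.
      go zero 9r≤κ _ = ≤-reflexive (trans (*-congˡ (×-congˡ (ℕ.m≤n⇒m∸n≡0 r≤d)))
        (solve 1 (λ k → con (+ 9) :* con (+ 0) := k :* (con (+ 0) :* con (+ 0))) refl κ))
        where
        r≤κ : fromℕ r ≤ κ
        r≤κ = ≤-trans (≤-by (*-nonneg (fromℕ-nonneg 8) (fromℕ-nonneg r))
            (solve 1 (λ r → con (+ 9) :* r := r :+ con (+ 8) :* r) refl (fromℕ r)))
          (≤-trans 9r≤κ (≤-reflexive (solve 1 (λ k → k :* ((con (+ 1) :+ con (+ 0)) :* (con (+ 1) :+ con (+ 0))) := k) refl κ)))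

        r≤d : r ℕ.≤ d
        r≤d = fromℕ-cancel-≤ (x²≤y²⇒x≤y (fromℕ-nonneg d) (≤-trans (*-monoʳ (fromℕ-nonneg r) r≤κ) κr≤d²))
      -- The budget falls from t + 2 to t + 1. With κ(t + 1) ≤ 3d, what remains is at most κ((t +
      -- 2)² - 3(t + 1)) = κ((t + 1)² - t).
      go (suc t) 9r≤κ[2+t]² κ[1+t]²≤9r = begin
        fromℕ 9 * fromℕ (r ℕ.∸ d)                             ≈⟨ *-congˡ (fromℕ-∸ d≤r) ⟩
        fromℕ 9 * (fromℕ r - fromℕ d)                         ≤⟨ ≤-by
            (+-nonneg (+-nonneg (0≤y-x 9r≤κ[2+t]²) (*-nonneg (fromℕ-nonneg 3) (0≤y-x κ[1+t]≤3d))) (*-nonneg (<⇒≤ 0<κ) (fromℕ-nonneg t)))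
            (solve 4 (λ k r d t → k :* ((con (+ 1) :+ t) :* (con (+ 1) :+ t)) := con (+ 9) :* (r :- d) :+
               (((k :* ((con (+ 1) :+ (con (+ 1) :+ t)) :* (con (+ 1) :+ (con (+ 1) :+ t))) :- con (+ 9) :* r) :+
                 con (+ 3) :* (con (+ 3) :* d :- k :* (con (+ 1) :+ t))) :+ k :* t)) refl κ (fromℕ r) (fromℕ d) (fromℕ t)) ⟩
        κ * (fromℕ (suc t) * fromℕ (suc t))                   ∎
        where
        κ[1+t]≤3d : κ * fromℕ (suc t) ≤ fromℕ 3 * fromℕ d
        κ[1+t]≤3d = x²≤y²⇒x≤y (*-nonneg (fromℕ-nonneg 3) (fromℕ-nonneg d)) (begin
          κ * fromℕ (suc t) * (κ * fromℕ (suc t))             ≈⟨ solve 2 (λ k t → k :* t :* (k :* t) := k :* (k :* (t :* t))) refl κ (fromℕ (suc t)) ⟩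
          κ * (κ * (fromℕ (suc t) * fromℕ (suc t)))           ≤⟨ *-monoˡ (<⇒≤ 0<κ) κ[1+t]²≤9r ⟩
          κ * (fromℕ 9 * fromℕ r)                             ≈⟨ solve 2 (λ k r → k :* (con (+ 9) :* r) := con (+ 9) :* (k :* r)) refl κ (fromℕ r) ⟩
          fromℕ 9 * (κ * fromℕ r)                             ≤⟨ *-monoˡ (fromℕ-nonneg 9) κr≤d² ⟩
          fromℕ 9 * (fromℕ d * fromℕ d)                       ≈⟨ solve 1 (λ d → con (+ 9) :* (d :* d) := con (+ 3) :* d :* (con (+ 3) :* d)) refl (fromℕ d) ⟩
          fromℕ 3 * fromℕ d * (fromℕ 3 * fromℕ d)             ∎)

    module _ {a b : ℕ} where

      -- A threshold of at most 1 needs no estimate: it is met because no vertex is isolated.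
      Poor : Subset a → BipartiteGraph a b → Set
      Poor U G = 2 ℕ.≤ threshold ∣ U ∣ × (∀ w → ∣ column G w ∩ U ∣ ℕ.< threshold ∣ U ∣)

      dominatingSet : ∀ G t → NoIsolatedVertex G → (∀ U → ¬ Poor U G) → WithinReach t a →
                      ∃[ D ] (∣ D ∣ ℕ.≤ t × Dominating G D)
      dominatingSet G t noIsolated notPoor reach =
        let D , ∣D∣≤t , dom = greedyDomination G threshold WithinReach WithinReach-zero WithinReach-suc rich t ⊤
              (≡.subst (WithinReach t) (≡.sym (∣⊤∣≡n a)) reach)
        in D , ∣D∣≤t , λ v → dom v ∈⊤
        where
        rich : ∀ U → Nonempty U → ∃[ w ] (threshold ∣ U ∣ ℕ.≤ ∣ column G w ∩ U ∣)
        rich U (v , v∈U) with em {∃[ w ] (threshold ∣ U ∣ ℕ.≤ ∣ column G w ∩ U ∣)} | 2 ℕ.≤? threshold ∣ U ∣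
        ... | yes found | _ = found
        ... | no none | yes 2≤s = contradiction (2≤s , λ w → ℕ.≰⇒> (λ s≤d → none (w , s≤d))) (notPoor U)
        ... | no none | no 2≰s = let w , w∈N = noIsolated v in
          w , ℕ.≤-trans (ℕ.s≤s⁻¹ (ℕ.≰⇒> 2≰s)) (Nonempty⇒∣p∣>0 (v , x∈p∩q⁺ (∈N⇒∈column G w∈N , v∈U)))

-- Probability bounds for fixed parameters

r≤2[r/s]s : ∀ r s → suc s ℕ.≤ r → r ℕ.≤ 2 ℕ.* ((r ℕ./ suc s) ℕ.* suc s)
r≤2[r/s]s r s 1+s≤r = begin
  r                                                            ≡⟨ ℕ.m≡m%n+[m/n]*n r (suc s) ⟩
  r ℕ.% suc s ℕ.+ (r ℕ./ suc s) ℕ.* suc s                      ≤⟨ ℕ.+-monoˡ-≤ _ (ℕ.<⇒≤ (ℕ.m%n<n r (suc s))) ⟩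
  -- As the divisor is at most `r`, the quotient is at least 1, and the rounded-down multiple is no
  -- smaller than the divisor.
  suc s ℕ.+ (r ℕ./ suc s) ℕ.* suc s                            ≤⟨ ℕ.+-monoˡ-≤ _ (ℕ.≤-trans (ℕ.≤-reflexive (≡.sym (ℕ.*-identityˡ (suc s)))) (ℕ.*-monoˡ-≤ (suc s) (ℕ.m≥n⇒m/n>0 1+s≤r))) ⟩
  (r ℕ./ suc s) ℕ.* suc s ℕ.+ (r ℕ./ suc s) ℕ.* suc s          ≡⟨ ≡.cong ((r ℕ./ suc s) ℕ.* suc s ℕ.+_) (≡.sym (ℕ.+-identityʳ _)) ⟩
  2 ℕ.* ((r ℕ./ suc s) ℕ.* suc s)                              ∎
  where open ℕ.≤-Reasoning

module Estimates (em : ExcludedMiddle 0ℓ) (R : CompleteOrderedField) where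
  open RealAnalysis em R
  open OrderedField em R
  open Series em R
  open Expectations em R
  open Threshold em R

  exp-neg≤1 : ∀ {x} → 0# ≤ x → exp (- x) ≤ 1#
  exp-neg≤1 {x} 0≤x = ≤-trans (exp-mono (≤-trans (neg-mono 0≤x) (≤-reflexive -0#≈0#))) (≤-reflexive exp-0)

  -- The defining equation makes `x` equal to 1/(1 + u), and 1 + u ≤ exp u is inverted.
  exp-neg-≤ : ∀ {x u} → 0# ≤ u → 0# ≤ x → x * (1# + u) ≈ 1# → exp (- u) ≤ x
  exp-neg-≤ {x} {u} 0≤u 0≤x x[1+u]≈1 = begin
    exp (- u)                      ≈⟨ sym (*-identityʳ _) ⟩
    exp (- u) * 1#                 ≈⟨ *-congˡ (sym x[1+u]≈1) ⟩
    exp (- u) * (x * (1# + u))     ≤⟨ *-monoˡ (<⇒≤ (exp-pos (- u))) (*-monoˡ 0≤x (1+x≤exp 0≤u)) ⟩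
    exp (- u) * (x * exp u)        ≈⟨ solve 3 (λ e x f → e :* (x :* f) := f :* e :* x) refl (exp (- u)) x (exp u) ⟩
    exp u * exp (- u) * x          ≈⟨ *-congʳ (exp-*-neg u) ⟩
    1# * x                         ≈⟨ *-identityˡ x ⟩
    x                              ∎

  bernoulli-inequality : ∀ {h} → 0# ≤ h → h ≤ 1# → ∀ n → 1# - fromℕ n * h ≤ (1# - h) ^ n
  bernoulli-inequality {h} 0≤h h≤1 zero = ≤-reflexive (solve 1 (λ h → con (+ 1) :- con (+ 0) :* h := con (+ 1)) refl h)
  bernoulli-inequality {h} 0≤h h≤1 (suc n) = begin
    1# - (1# + fromℕ n) * h             ≤⟨ ≤-by (*-nonneg (fromℕ-nonneg n) (*-nonneg 0≤h 0≤h))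
        (solve 2 (λ n h → (con (+ 1) :- h) :* (con (+ 1) :- n :* h) := con (+ 1) :- (con (+ 1) :+ n) :* h :+ n :* (h :* h)) refl (fromℕ n) h) ⟩
    (1# - h) * (1# - fromℕ n * h)       ≤⟨ *-monoˡ (0≤y-x h≤1) (bernoulli-inequality 0≤h h≤1 n) ⟩
    (1# - h) * (1# - h) ^ n             ∎

  module _ (p : ℝ) (0<p : 0# < p) (p≤1 : p ≤ 1#) (ζ κ : ℝ) (0<κ : 0# < κ) (4κ≤1 : fromℕ 4 * κ ≤ 1#)
           (8κ≤ζp : fromℕ 8 * κ ≤ ζ * p) (0≤ζ : 0# ≤ ζ) where
    open Bernoulli p (<⇒≤ 0<p) p≤1

    -- With m = ⌊r/s⌋ and u = 1/(pm): (1 + u)⁻ˢ ≥ exp (- su), and su ≤ ζ as s² ≤ 4κr ≤ 8κms.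
    ℙ-threshold-groups : ∀ {n} (U : Subset n) s m → 1 ℕ.≤ m →
      suc s ℕ.* m ℕ.≤ ∣ U ∣ → ∣ U ∣ ℕ.≤ 2 ℕ.* (m ℕ.* suc s) →
      fromℕ (suc s) * fromℕ (suc s) ≤ fromℕ 4 * (κ * fromℕ ∣ U ∣) →
      exp (- ζ) ≤ ℙ-∣c∩U∣> U s
    ℙ-threshold-groups U s (suc m′) _ [1+s]m≤r r≤2ms s²≤4κr = begin
      exp (- ζ)                       ≤⟨ exp-mono (≤-trans (neg-mono su≤ζ) (≤-reflexive (-‿distribʳ-* _ _))) ⟩
      exp (fromℕ (suc s) * (- u))     ≈⟨ exp-fromℕ-* (suc s) (- u) ⟩
      exp (- u) ^ suc s               ≤⟨ ^-mono (suc s) (<⇒≤ (exp-pos (- u))) (exp-neg-≤ (<⇒≤ 0<u) 0≤mq mq[1+u]≈1) ⟩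
      (fromℕ m * q) ^ suc s           ≤⟨ ℙ-∣c∩U∣>-groups m q 0≤q (≤-reflexive q[1+pm]≈p) U s m ℕ.≤-refl [1+s]m≤r ⟩
      ℙ-∣c∩U∣> U s                    ∎
      where
      m = suc m′
      pm = p * fromℕ m
      u = pm ⁻¹
      i = (1# + pm) ⁻¹
      -- The largest value that q(1 + pm) ≤ p allows. It gives mq = pm/(1 + pm) = 1/(1 + u), which
      -- is what `exp-neg-≤` bounds below.
      q = p * i

      0<pm : 0# < pm
      0<pm = *-pos 0<p (fromℕ-pos m′)

      0<1+pm : 0# < 1# + pm
      0<1+pm = +-pos 0<1 (<⇒≤ 0<pm)

      0<u : 0# < u
      0<u = ⁻¹-pos 0<pm

      0≤q : 0# ≤ q
      0≤q = *-nonneg (<⇒≤ 0<p) (<⇒≤ (⁻¹-pos 0<1+pm))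

      0≤mq : 0# ≤ fromℕ m * q
      0≤mq = *-nonneg (fromℕ-nonneg m) 0≤q

      q[1+pm]≈p : q * (1# + pm) ≈ p
      q[1+pm]≈p = trans (solve 3 (λ p i x → p :* i :* x := p :* (x :* i)) refl p i (1# + pm))
        (trans (*-congˡ (*-inverseʳ 0<1+pm)) (*-identityʳ p))

      mq[1+u]≈1 : fromℕ m * q * (1# + u) ≈ 1#
      mq[1+u]≈1 = begin-equality
        fromℕ m * q * (1# + u)        ≈⟨ solve 4 (λ m p i u → m :* (p :* i) :* (con (+ 1) :+ u) := (p :* m :+ p :* m :* u) :* i) refl (fromℕ m) p i u ⟩
        (pm + pm * u) * i             ≈⟨ *-congʳ (trans (+-congˡ (*-inverseʳ 0<pm)) (+-comm pm 1#)) ⟩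
        (1# + pm) * i                 ≈⟨ *-inverseʳ 0<1+pm ⟩
        1#                            ∎

      s≤8κm : fromℕ (suc s) ≤ fromℕ 8 * κ * fromℕ m
      s≤8κm = *-cancelˡ-≤ (fromℕ-pos s) (begin
        fromℕ (suc s) * fromℕ (suc s)                          ≤⟨ s²≤4κr ⟩
        fromℕ 4 * (κ * fromℕ ∣ U ∣)                            ≤⟨ *-monoˡ (fromℕ-nonneg 4) (*-monoˡ (<⇒≤ 0<κ) (fromℕ-mono r≤2ms)) ⟩
        fromℕ 4 * (κ * fromℕ (2 ℕ.* (m ℕ.* suc s)))            ≈⟨ *-congˡ (*-congˡ (trans (fromℕ-* 2 (m ℕ.* suc s)) (*-congˡ (fromℕ-* m (suc s))))) ⟩
        fromℕ 4 * (κ * (fromℕ 2 * (fromℕ m * fromℕ (suc s))))  ≈⟨ solve 3 (λ k m s → con (+ 4) :* (k :* (con (+ 2) :* (m :* s))) := s :* (con (+ 8) :* k :* m)) refl κ (fromℕ m) (fromℕ (suc s)) ⟩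
        fromℕ (suc s) * (fromℕ 8 * κ * fromℕ m)                ∎)

      su≤ζ : fromℕ (suc s) * u ≤ ζ
      su≤ζ = begin
        fromℕ (suc s) * u             ≤⟨ *-monoʳ (<⇒≤ 0<u) (≤-trans s≤8κm (*-monoʳ (fromℕ-nonneg m) 8κ≤ζp)) ⟩
        ζ * p * fromℕ m * u           ≈⟨ solve 4 (λ z p m u → z :* p :* m :* u := z :* (p :* m :* u)) refl ζ p (fromℕ m) u ⟩
        ζ * (pm * u)                  ≈⟨ trans (*-congˡ (*-inverseʳ 0<pm)) (*-identityʳ ζ) ⟩
        ζ                             ∎

    ℙ-threshold : ∀ {n} (U : Subset n) s → threshold κ 0<κ ∣ U ∣ ≡ suc (suc s) → exp (- ζ) ≤ ℙ-∣c∩U∣> U (suc s)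
    ℙ-threshold U s eq = ℙ-threshold-groups U (suc s) (r ℕ./ suc (suc s)) (ℕ.m≥n⇒m/n>0 s+2≤r)
        (ℕ.≤-trans (ℕ.≤-reflexive (ℕ.*-comm (suc (suc s)) (r ℕ./ suc (suc s)))) (ℕ.m/n*n≤m r (suc (suc s))))
        (r≤2[r/s]s r (suc s) s+2≤r) s²≤4κr
      where
      r = ∣ U ∣

      -- The cost of rounding up: minimality of the threshold gives (s + 1)² < κr, and s + 2 ≤ 2(s +
      -- 1). This needs a threshold of at least 2.
      s²≤4κr : fromℕ (suc (suc s)) * fromℕ (suc (suc s)) ≤ fromℕ 4 * (κ * fromℕ r)
      s²≤4κr = begin
        fromℕ (suc (suc s)) * fromℕ (suc (suc s))          ≤⟨ ≤-by (+-nonneg (*-nonneg (fromℕ-nonneg 3) (*-nonneg (fromℕ-nonneg s) (fromℕ-nonneg s))) (*-nonneg (fromℕ-nonneg 4) (fromℕ-nonneg s)))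
            (solve 1 (λ s → con (+ 4) :* ((con (+ 1) :+ s) :* (con (+ 1) :+ s)) :=
              (con (+ 1) :+ (con (+ 1) :+ s)) :* (con (+ 1) :+ (con (+ 1) :+ s)) :+ (con (+ 3) :* (s :* s) :+ con (+ 4) :* s)) refl (fromℕ s)) ⟩
        fromℕ 4 * (fromℕ (suc s) * fromℕ (suc s))          ≤⟨ *-monoˡ (fromℕ-nonneg 4) (<⇒≤ (threshold-1<κr κ 0<κ r eq)) ⟩
        fromℕ 4 * (κ * fromℕ r)                            ∎

      -- With 4κ ≤ 1 the number of groups is at most its square, hence at most r, so that groups of
      -- size ⌊r/(s + 2)⌋ are not empty.
      s+2≤r : suc (suc s) ℕ.≤ r
      s+2≤r = ℕ.≤-trans (ℕ.m≤m*n (suc (suc s)) (suc (suc s))) (fromℕ-cancel-≤ (begin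
        fromℕ (suc (suc s) ℕ.* suc (suc s))                ≈⟨ fromℕ-* (suc (suc s)) (suc (suc s)) ⟩
        fromℕ (suc (suc s)) * fromℕ (suc (suc s))          ≤⟨ s²≤4κr ⟩
        fromℕ 4 * (κ * fromℕ r)                            ≈⟨ sym (*-assoc _ _ _) ⟩
        fromℕ 4 * κ * fromℕ r                              ≤⟨ *-monoʳ (fromℕ-nonneg r) 4κ≤1 ⟩
        1# * fromℕ r                                       ≈⟨ *-identityˡ _ ⟩
        fromℕ r                                            ∎))

    module _ (a b : ℕ) where
      private
        module Graph = IsExpectation (𝔼Graph-isExpectation a b)
        module Col = IsExpectation (𝔼Subset-isExpectation a)

        q : ℝ
        q = exp (- ζ)

      ℙ-allColumns< : ∀ (U : Subset a) s → threshold κ 0<κ ∣ U ∣ ≡ suc (suc s) →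
        𝔼Graph a b (λ G → 𝟙 (∀ w → ∣ column G w ∩ U ∣ ℕ.< suc (suc s))) ≤ exp (fromℕ b * (- q))
      ℙ-allColumns< U s eq = begin
        𝔼Graph a b (λ G → 𝟙 (∀ w → ∣ column G w ∩ U ∣ ℕ.< suc (suc s)))   ≈⟨ 𝔼Graph-∀-column a b (λ c → ∣ c ∩ U ∣ ℕ.< suc (suc s)) ⟩
        𝔼Subset a (λ c → 𝟙 (∣ c ∩ U ∣ ℕ.< suc (suc s))) ^ b               ≤⟨ ^-mono b (Col.E-nonneg (λ c → 𝟙-nonneg _)) fewer≤exp ⟩
        exp (- q) ^ b                                                     ≈⟨ sym (exp-fromℕ-* b (- q)) ⟩
        exp (fromℕ b * (- q))                                             ∎
        where
        complement : ∀ c → 𝟙 (suc s ℕ.< ∣ c ∩ U ∣) + 𝟙 (∣ c ∩ U ∣ ℕ.< suc (suc s)) ≈ 1#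
        complement c with suc s ℕ.<? ∣ c ∩ U ∣
        ... | yes s<d = trans (+-cong (𝟙-yes s<d) (𝟙-no (λ d<s+2 → ℕ.<⇒≱ s<d (ℕ.s≤s⁻¹ d<s+2)))) (+-identityʳ 1#)
        ... | no s≮d  = trans (+-cong (𝟙-no s≮d) (𝟙-yes (s≤s (ℕ.≮⇒≥ s≮d)))) (+-identityˡ 1#)

        total≈1 : ℙ-∣c∩U∣> U (suc s) + 𝔼Subset a (λ c → 𝟙 (∣ c ∩ U ∣ ℕ.< suc (suc s))) ≈ 1#
        total≈1 = trans (sym (Col.+-homo _ _)) (trans (Col.cong complement) Col.E-1)

        fewer≤exp : 𝔼Subset a (λ c → 𝟙 (∣ c ∩ U ∣ ℕ.< suc (suc s))) ≤ exp (- q)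
        fewer≤exp = begin
          𝔼Subset a (λ c → 𝟙 (∣ c ∩ U ∣ ℕ.< suc (suc s)))   ≈⟨ solve 2 (λ x y → y := (x :+ y) :- x) refl (ℙ-∣c∩U∣> U (suc s)) _ ⟩
          _ - ℙ-∣c∩U∣> U (suc s)                            ≈⟨ +-congʳ total≈1 ⟩
          1# - ℙ-∣c∩U∣> U (suc s)                           ≤⟨ +-monoˡ 1# (neg-mono (ℙ-threshold U s eq)) ⟩
          1# - q                                            ≤⟨ 1-x≤exp-neg (<⇒≤ (exp-pos _)) (exp-neg≤1 0≤ζ) ⟩
          exp (- q)                                         ∎

      ℙ-Poor : ∀ U → 𝔼Graph a b (λ G → 𝟙 (Poor κ 0<κ U G)) ≤ exp (fromℕ b * (- q))
      ℙ-Poor U = byThreshold (threshold κ 0<κ ∣ U ∣) ≡.refl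
        where
        never : ¬ (2 ℕ.≤ threshold κ 0<κ ∣ U ∣) → 𝔼Graph a b (λ G → 𝟙 (Poor κ 0<κ U G)) ≤ exp (fromℕ b * (- q))
        never ¬2≤s = ≤-trans (≤-reflexive (trans (Graph.cong (λ G → 𝟙-no (λ (2≤s , _) → ¬2≤s 2≤s))) (Graph.E-const 0#)))
          (<⇒≤ (exp-pos _))

        byThreshold : ∀ s → threshold κ 0<κ ∣ U ∣ ≡ s → 𝔼Graph a b (λ G → 𝟙 (Poor κ 0<κ U G)) ≤ exp (fromℕ b * (- q))
        byThreshold zero eq = never λ 2≤s → contradiction (≡.subst (2 ℕ.≤_) eq 2≤s) λ ()
        byThreshold (suc zero) eq = never λ 2≤s → contradiction (≡.subst (2 ℕ.≤_) eq 2≤s) λ { (s≤s ()) }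
        byThreshold (suc (suc s)) eq = ≤-trans
          (Graph.mono (λ G → 𝟙-mono (λ (_ , few) w → ≡.subst (∣ column G w ∩ U ∣ ℕ.<_) eq (few w))))
          (ℙ-allColumns< U s eq)

      -- The union bound holds pointwise: a graph without isolated vertices lies in `E` or has some
      -- poor `U`. It is stated for the joint event, so the division by the probability of the
      -- condition can wait.
      ℙ-failure : (E : Pred (BipartiteGraph a b) 0ℓ) →
        (∀ G → NoIsolatedVertex G → (∀ U → ¬ Poor κ 0<κ U G) → E G) →
        RandomBipartiteGraph.ℙ[_] a b p NoIsolatedVertex ≤
        RandomBipartiteGraph.ℙ[_] a b p (E Unary.∩ NoIsolatedVertex) + fromℕ 2 ^ a * exp (fromℕ b * (- q))
      ℙ-failure E good⇒E = begin
        RandomBipartiteGraph.ℙ[_] a b p NoIsolatedVertex                               ≈⟨ ℙ≈𝔼 a b NoIsolatedVertex ⟩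
        𝔼Graph a b (λ G → 𝟙 (NoIsolatedVertex G))                                      ≤⟨ Graph.mono pointwise ⟩
        𝔼Graph a b (λ G → 𝟙 (E G × NoIsolatedVertex G) + sumOver subsets (λ U → 𝟙 (Poor κ 0<κ U G)))
                                                                                       ≈⟨ Graph.+-homo _ _ ⟩
        𝔼Graph a b (λ G → 𝟙 (E G × NoIsolatedVertex G)) + 𝔼Graph a b (λ G → sumOver subsets (λ U → 𝟙 (Poor κ 0<κ U G)))
                                                                                       ≈⟨ +-cong (sym (ℙ≈𝔼 a b (E Unary.∩ NoIsolatedVertex)))
                                                                                            (E-sumOver (𝔼Graph-isExpectation a b) subsets (λ U G → 𝟙 (Poor κ 0<κ U G))) ⟩
        _ + sumOver subsets (λ U → 𝔼Graph a b (λ G → 𝟙 (Poor κ 0<κ U G)))              ≤⟨ +-monoˡ _ (sumOver-mono subsets ℙ-Poor) ⟩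
        _ + sumOver subsets (λ _ → exp (fromℕ b * (- q)))                              ≈⟨ +-congˡ (sumOver-subsets-const a _) ⟩
        RandomBipartiteGraph.ℙ[_] a b p (E Unary.∩ NoIsolatedVertex) + fromℕ 2 ^ a * exp (fromℕ b * (- q)) ∎
        where
        subsets = allVecs (inside ∷ outside ∷ []) a

        Poors : BipartiteGraph a b → ℝ
        Poors G = sumOver subsets (λ U → 𝟙 (Poor κ 0<κ U G))

        poor≤poors : ∀ G U → 𝟙 (Poor κ 0<κ U G) ≤ Poors G
        poor≤poors G = sumOver-subsets-≤ (λ U → 𝟙 (Poor κ 0<κ U G)) (λ U → 𝟙-nonneg _)

        0≤poors : ∀ G → 0# ≤ Poors G
        0≤poors G = ≤-trans (𝟙-nonneg _) (poor≤poors G ⊤)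

        pointwise : ∀ G → 𝟙 (NoIsolatedVertex G) ≤ 𝟙 (E G × NoIsolatedVertex G) + Poors G
        pointwise G with em {∃[ U ] Poor κ 0<κ U G}
        ... | yes (U , poor) = begin
          𝟙 (NoIsolatedVertex G)                      ≤⟨ 𝟙-mono (λ _ → poor) ⟩
          𝟙 (Poor κ 0<κ U G)                          ≤⟨ poor≤poors G U ⟩
          Poors G                                     ≤⟨ ≤-by (𝟙-nonneg _) (+-comm _ _) ⟩
          𝟙 (E G × NoIsolatedVertex G) + Poors G      ∎
        ... | no nonePoor = ≤-trans
          (𝟙-mono (λ noIsolated → good⇒E G noIsolated (λ U poor → nonePoor (U , poor)) , noIsolated))
          (x≤x+y (0≤poors G))

      -- The rows are independent, so the probability is exactly (1 - (1 - p)ᵇ)ᵃ, and Bernoulli's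
      -- inequality applies.
      ℙ-NoIsolatedVertex : 1# - fromℕ a * exp (fromℕ b * (- p)) ≤ RandomBipartiteGraph.ℙ[_] a b p NoIsolatedVertex
      ℙ-NoIsolatedVertex = begin
        1# - fromℕ a * exp (fromℕ b * (- p))                      ≤⟨ +-monoˡ 1# (neg-mono (*-monoˡ (fromℕ-nonneg a) h≤exp)) ⟩
        1# - fromℕ a * (1# - p) ^ b                               ≤⟨ bernoulli-inequality (^-nonneg b 0≤1-p) h≤1 a ⟩
        (1# - (1# - p) ^ b) ^ a                                   ≈⟨ ^-congˡ a (sym (ℙ-Nonempty b)) ⟩
        𝔼Subset b (λ U → 𝟙 (Nonempty U)) ^ a                      ≈⟨ sym (𝔼Vec-∀ (𝔼Subset-isExpectation b) a Nonempty) ⟩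
        𝔼Graph a b (λ G → 𝟙 (NoIsolatedVertex G))                 ≈⟨ sym (ℙ≈𝔼 a b NoIsolatedVertex) ⟩
        RandomBipartiteGraph.ℙ[_] a b p NoIsolatedVertex          ∎
        where
        h≤exp : (1# - p) ^ b ≤ exp (fromℕ b * (- p))
        h≤exp = ≤-trans (^-mono b 0≤1-p (1-x≤exp-neg (<⇒≤ 0<p) p≤1)) (≤-reflexive (sym (exp-fromℕ-* b (- p))))

        h≤1 : (1# - p) ^ b ≤ 1#
        h≤1 = ≤-trans h≤exp (≤-trans (exp-mono (≤-reflexive (sym (-‿distribʳ-* _ _))))
          (exp-neg≤1 (*-nonneg (fromℕ-nonneg b) (<⇒≤ 0<p))))

-- Inequalities at a single n and the conditional probability

module Domination (em : ExcludedMiddle 0ℓ) (R : CompleteOrderedField) where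
  open RealAnalysis em R
  open RandomBipartiteGraph
  open OrderedField em R
  open Limits em R
  open Series em R
  open Threshold em R
  open Estimates em R

  2≤exp1 : fromℕ 2 ≤ exp 1#
  2≤exp1 = ≤-trans (≤-reflexive (+-congˡ (+-identityʳ 1#))) (1+x≤exp 0≤1)

  -- The square of x/2 ≤ exp (x/2). All comparisons of ln n with powers of n are drawn from this
  -- bound.
  x²≤4exp : ∀ {x} → 0# ≤ x → x * x ≤ fromℕ 4 * exp x
  x²≤4exp {x} 0≤x = begin
    x * x                               ≈⟨ *-cong (sym (x/2+x/2≈x x)) (sym (x/2+x/2≈x x)) ⟩
    (h + h) * (h + h)                   ≈⟨ solve 1 (λ h → (h :+ h) :* (h :+ h) := con (+ 4) :* (h :* h)) refl h ⟩
    fromℕ 4 * (h * h)                   ≤⟨ *-monoˡ (fromℕ-nonneg 4) (*-mono 0≤h 0≤h h≤exp h≤exp) ⟩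
    fromℕ 4 * (exp h * exp h)           ≈⟨ *-congˡ (sym (exp-+ h h)) ⟩
    fromℕ 4 * exp (h + h)               ≈⟨ *-congˡ (exp-cong (x/2+x/2≈x x)) ⟩
    fromℕ 4 * exp x                     ∎
    where
    h = x /2

    0≤h : 0# ≤ h
    0≤h = *-nonneg 0≤x (<⇒≤ (⁻¹-pos (fromℕ-pos 1)))

    h≤exp : h ≤ exp h
    h≤exp = ≤-trans (≤-by 0≤1 (+-comm 1# h)) (1+x≤exp 0≤h)

  SmallDominatingSet : ∀ (a b : ℕ) → ℝ → ℝ → Pred (BipartiteGraph a b) 0ℓ
  SmallDominatingSet a b p f G = ∃[ D ] (Dominating G D × fromℕ ∣ D ∣ ≤ f / p)

  -- The asymptotic conditions appear as numerical ones at one `n`. From 16η ≤ β comes ζ ≤ βL/2;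
  -- from 4ηα ≤ 1 comes 4κ ≤ 1; 64α ≤ β²L and 8 ≤ β²L make powers of n beat multiples of L. The
  -- quantities `η` and `ε` enter through the equations that they solve.
  module _ {α β : ℝ} (0<β : 0# < β) {n a b : ℕ} {p f η ε : ℝ}
    (0<p : 0# < p) (p≤1 : p ≤ 1#) (L²≤a : ln (fromℕ n) ^ 2 ≤ fromℕ a) (a≤b : a ℕ.≤ b) (b≤n : b ℕ.≤ n)
    (ap≤αL : fromℕ a * p ≤ α * ln (fromℕ n)) (nᵝ<bp : fromℕ n ^ʳ β < fromℕ b * p)
    (1≤f : 1# ≤ f) (ηf≈36α : η * f ≈ fromℕ 36 * α) (0<η : 0# < η) (16η≤β : fromℕ 16 * η ≤ β) (4ηα≤1 : fromℕ 4 * (η * α) ≤ 1#)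
    (1≤L : 1# ≤ ln (fromℕ n)) (64α≤β²L : fromℕ 64 * α ≤ β * β * ln (fromℕ n)) (8≤β²L : fromℕ 8 ≤ β * β * ln (fromℕ n))
    (0≤ε : 0# ≤ ε) (εβL≈8ηL+1 : ε * (β * ln (fromℕ n)) ≈ fromℕ 8 * η * ln (fromℕ n) + 1#)
    where

    private
      L = ln (fromℕ n)
      ζ = fromℕ 8 * η * L
      κ = η * L * p
      q = exp (- ζ)

      0<L : 0# < L
      0<L = <-≤-trans 0<1 1≤L

      0<κ : 0# < κ
      0<κ = *-pos (*-pos 0<η 0<L) 0<p

      0≤βL : 0# ≤ β * L
      0≤βL = *-nonneg (<⇒≤ 0<β) (<⇒≤ 0<L)

      0≤ζ : 0# ≤ ζ
      0≤ζ = *-nonneg (*-nonneg (fromℕ-nonneg 8) (<⇒≤ 0<η)) (<⇒≤ 0<L)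

      1≤a : 1# ≤ fromℕ a
      1≤a = begin
        1#                ≈⟨ sym (*-identityˡ 1#) ⟩
        1# * 1#           ≤⟨ *-mono 0≤1 0≤1 1≤L 1≤L ⟩
        L * L             ≈⟨ *-congˡ (sym (*-identityʳ L)) ⟩
        L ^ 2             ≤⟨ L²≤a ⟩
        fromℕ a           ∎

      a≤b′ : fromℕ a ≤ fromℕ b
      a≤b′ = fromℕ-mono a≤b

      b≤n′ : fromℕ b ≤ fromℕ n
      b≤n′ = fromℕ-mono b≤n

      expL≈n : exp L ≈ fromℕ n
      expL≈n = exp-ln (≤-trans 1≤a (≤-trans a≤b′ b≤n′))

      -- From L²p ≤ ap ≤ αL, cancelling L.
      pL≤α : p * L ≤ α
      pL≤α = *-cancelˡ-≤ 0<L (begin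
        L * (p * L)       ≈⟨ solve 2 (λ p L → L :* (p :* L) := (L :* (L :* con (+ 1))) :* p) refl p L ⟩
        L ^ 2 * p         ≤⟨ *-monoʳ (<⇒≤ 0<p) L²≤a ⟩
        fromℕ a * p       ≤⟨ ap≤αL ⟩
        α * L             ≈⟨ *-comm α L ⟩
        L * α             ∎)

      4κ≤1 : fromℕ 4 * κ ≤ 1#
      4κ≤1 = begin
        fromℕ 4 * κ                ≈⟨ solve 3 (λ η L p → con (+ 4) :* (η :* L :* p) := con (+ 4) :* (η :* (p :* L))) refl η L p ⟩
        fromℕ 4 * (η * (p * L))    ≤⟨ *-monoˡ (fromℕ-nonneg 4) (*-monoˡ (<⇒≤ 0<η) pL≤α) ⟩
        fromℕ 4 * (η * α)          ≤⟨ 4ηα≤1 ⟩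
        1#                         ∎

      8κ≤ζp : fromℕ 8 * κ ≤ ζ * p
      8κ≤ζp = ≤-reflexive (solve 3 (λ η L p → con (+ 8) :* (η :* L :* p) := con (+ 8) :* η :* L :* p) refl η L p)

      f≈p[f/p] : f ≈ p * (f / p)
      f≈p[f/p] = sym (trans (solve 3 (λ p f i → p :* (f :* i) := f :* (p :* i)) refl p f (p ⁻¹))
        (trans (*-congˡ (*-inverseʳ 0<p)) (*-identityʳ f)))

      1≤f/p : 1# ≤ f / p
      1≤f/p = *-cancelˡ-≤ 0<p (≤-trans (≤-reflexive (*-identityʳ p)) (≤-trans p≤1 (≤-trans 1≤f (≤-reflexive f≈p[f/p]))))

    -- Since f/p ≥ 1, its floor t is positive, and f/p < t + 1 ≤ 2t. Replacing t by f/(2p) costs a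
    -- factor 4, and 4 · 9 = 36 is the constant in `η`.
    ⌊f/p⌋-withinReach : ∀ t → f / p < fromℕ (suc t) → WithinReach κ 0<κ t a
    ⌊f/p⌋-withinReach zero f/p<1 = contradiction (≤-trans (≤-reflexive (+-identityʳ 1#)) 1≤f/p) (<⇒≱ f/p<1)
    ⌊f/p⌋-withinReach (suc t) f/p<2+t = *-cancelˡ-≤ (*-pos (fromℕ-pos 3) 0<p) (begin
      fromℕ 4 * p * (fromℕ 9 * fromℕ a)               ≈⟨ solve 2 (λ p a → con (+ 4) :* p :* (con (+ 9) :* a) := con (+ 36) :* (a :* p)) refl p (fromℕ a) ⟩
      fromℕ 36 * (fromℕ a * p)                        ≤⟨ *-monoˡ (fromℕ-nonneg 36) ap≤αL ⟩
      fromℕ 36 * (α * L)                              ≈⟨ trans (sym (*-assoc _ _ _)) (*-congʳ (sym ηf≈36α)) ⟩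
      η * f * L                                       ≈⟨ solve 3 (λ η f L → η :* f :* L := η :* L :* (con (+ 1) :* f)) refl η f L ⟩
      -- Only ηf² ≥ 36α is needed; one factor f ≥ 1 is spare.
      η * L * (1# * f)                                ≤⟨ *-monoˡ 0≤ηL (*-monoʳ 0≤f 1≤f) ⟩
      η * L * (f * f)                                 ≤⟨ *-monoˡ 0≤ηL (*-mono 0≤f 0≤f f≤2pt f≤2pt) ⟩
      η * L * (p * (fromℕ 2 * T) * (p * (fromℕ 2 * T)))  ≈⟨ solve 4 (λ η L p t → η :* L :* (p :* (con (+ 2) :* t) :* (p :* (con (+ 2) :* t))) :=
                                                           con (+ 4) :* p :* (η :* L :* p :* (t :* t))) refl η L p T ⟩
      fromℕ 4 * p * (κ * (T * T))                     ∎)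
      where
      T = fromℕ (suc t)

      0≤f : 0# ≤ f
      0≤f = ≤-trans 0≤1 1≤f

      0≤ηL : 0# ≤ η * L
      0≤ηL = *-nonneg (<⇒≤ 0<η) (<⇒≤ 0<L)

      f≤2pt : f ≤ p * (fromℕ 2 * T)
      f≤2pt = ≤-trans (≤-reflexive f≈p[f/p]) (*-monoˡ (<⇒≤ 0<p) (≤-trans (<⇒≤ f/p<2+t)
        (≤-by (fromℕ-nonneg t) (solve 1 (λ t → con (+ 2) :* (con (+ 1) :+ t) := con (+ 1) :+ (con (+ 1) :+ t) :+ t) refl (fromℕ t)))))

    smallDominatingSet : ∀ G → NoIsolatedVertex G → (∀ U → ¬ Poor κ 0<κ U G) → SmallDominatingSet a b p f G
    smallDominatingSet G noIsolated notPoor =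
      let t , t≤f/p , f/p<1+t = floor (≤-trans 0≤1 1≤f/p)
          D , ∣D∣≤t , dom = dominatingSet κ 0<κ G t noIsolated notPoor (⌊f/p⌋-withinReach t f/p<1+t)
      in D , dom , ≤-trans (fromℕ-mono ∣D∣≤t) t≤f/p

    -- As bp > exp (βL) ≥ 2L ≥ 1 + L, the expected number of isolated vertices is at most a exp (-
    -- bp) ≤ n exp (- (1 + L)) = 1/e ≤ 1/2.
    1/2≤ℙ-NoIsolatedVertex : 1# ≤ fromℕ 2 * ℙ[_] a b p NoIsolatedVertex
    1/2≤ℙ-NoIsolatedVertex = begin
      1#                                                         ≈⟨ solve 0 (con (+ 1) := con (+ 2) :- con (+ 1)) refl ⟩
      fromℕ 2 - 1#                                               ≤⟨ +-monoˡ (fromℕ 2) (neg-mono 2x≤1) ⟩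
      fromℕ 2 - fromℕ 2 * x                                      ≈⟨ solve 1 (λ x → con (+ 2) :- con (+ 2) :* x := con (+ 2) :* (con (+ 1) :- x)) refl x ⟩
      fromℕ 2 * (1# - x)                                         ≤⟨ *-monoˡ (fromℕ-nonneg 2)
          (ℙ-NoIsolatedVertex p 0<p p≤1 ζ κ 0<κ 4κ≤1 8κ≤ζp 0≤ζ a b) ⟩
      fromℕ 2 * ℙ[_] a b p NoIsolatedVertex                      ∎
      where
      x = fromℕ a * exp (fromℕ b * (- p))

      2L≤exp : fromℕ 2 * L ≤ exp (β * L)
      2L≤exp = *-cancelˡ-≤ (fromℕ-pos 3) (begin
        fromℕ 4 * (fromℕ 2 * L)       ≈⟨ solve 1 (λ L → con (+ 4) :* (con (+ 2) :* L) := con (+ 8) :* L) refl L ⟩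
        fromℕ 8 * L                   ≤⟨ *-monoʳ (<⇒≤ 0<L) 8≤β²L ⟩
        β * β * L * L                 ≈⟨ solve 2 (λ β L → β :* β :* L :* L := β :* L :* (β :* L)) refl β L ⟩
        β * L * (β * L)               ≤⟨ x²≤4exp 0≤βL ⟩
        fromℕ 4 * exp (β * L)         ∎)

      1+L≤bp : 1# + L ≤ fromℕ b * p
      1+L≤bp = begin
        1# + L                        ≤⟨ +-mono-≤ L 1≤L ⟩
        L + L                         ≈⟨ solve 1 (λ L → L :+ L := con (+ 2) :* L) refl L ⟩
        fromℕ 2 * L                   ≤⟨ 2L≤exp ⟩
        exp (β * L)                   ≤⟨ <⇒≤ nᵝ<bp ⟩
        fromℕ b * p                   ∎

      2x≤1 : fromℕ 2 * x ≤ 1#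
      2x≤1 = begin
        fromℕ 2 * x                                 ≤⟨ *-mono (fromℕ-nonneg 2) (*-nonneg (fromℕ-nonneg a) (<⇒≤ (exp-pos _))) 2≤exp1
            (*-mono (fromℕ-nonneg a) (<⇒≤ (exp-pos _)) (≤-trans (≤-trans a≤b′ b≤n′) (≤-reflexive (sym expL≈n)))
              (exp-mono (≤-trans (≤-reflexive (sym (-‿distribʳ-* _ _))) (neg-mono 1+L≤bp)))) ⟩
        exp 1# * (exp L * exp (- (1# + L)))         ≈⟨ sym (trans (exp-+ _ _) (*-congˡ (exp-+ _ _))) ⟩
        exp (1# + (L + - (1# + L)))                 ≈⟨ exp-cong (solve 1 (λ L → con (+ 1) :+ (L :+ :- (con (+ 1) :+ L)) := con (+ 0)) refl L) ⟩
        exp 0#                                      ≈⟨ exp-0 ⟩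
        1#                                          ∎

    -- Multiplying by n^β allows n^β to be replaced by bp on the left. Then p joins a, and ap ≤ αL
    -- leaves a logarithm to be compared with exp (βL - ζ), which is at least n^(β/2).
    4a≤bq : fromℕ 4 * fromℕ a ≤ fromℕ b * q
    4a≤bq = *-cancelˡ-≤ (exp-pos (β * L)) (begin
      exp (β * L) * (fromℕ 4 * fromℕ a)              ≤⟨ *-monoʳ (*-nonneg (fromℕ-nonneg 4) (fromℕ-nonneg a)) (<⇒≤ nᵝ<bp) ⟩
      fromℕ b * p * (fromℕ 4 * fromℕ a)              ≈⟨ solve 3 (λ b p a → b :* p :* (con (+ 4) :* a) := con (+ 4) :* b :* (a :* p)) refl (fromℕ b) p (fromℕ a) ⟩
      fromℕ 4 * fromℕ b * (fromℕ a * p)              ≤⟨ *-monoˡ (*-nonneg (fromℕ-nonneg 4) (fromℕ-nonneg b)) ap≤αL ⟩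
      fromℕ 4 * fromℕ b * (α * L)                    ≈⟨ solve 3 (λ b α L → con (+ 4) :* b :* (α :* L) := b :* (con (+ 4) :* (α :* L))) refl (fromℕ b) α L ⟩
      fromℕ b * (fromℕ 4 * (α * L))                  ≤⟨ *-monoˡ (fromℕ-nonneg b) 4αL≤exp ⟩
      fromℕ b * exp (β * L - ζ)                      ≈⟨ *-congˡ (exp-+ _ _) ⟩
      fromℕ b * (exp (β * L) * q)                    ≈⟨ solve 3 (λ b e q → b :* (e :* q) := e :* (b :* q)) refl (fromℕ b) (exp (β * L)) q ⟩
      exp (β * L) * (fromℕ b * q)                    ∎)
      where
      y = (β * L) /2

      0≤y : 0# ≤ y
      0≤y = *-nonneg 0≤βL (<⇒≤ (⁻¹-pos (fromℕ-pos 1)))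

      2y≈βL : y + y ≈ β * L
      2y≈βL = x/2+x/2≈x (β * L)

      y≤βL-ζ : y ≤ β * L - ζ
      y≤βL-ζ = *-cancelˡ-≤ (fromℕ-pos 1) (begin
        fromℕ 2 * y                      ≈⟨ trans (solve 1 (λ y → con (+ 2) :* y := y :+ y) refl y) 2y≈βL ⟩
        β * L                            ≤⟨ ≤-by (*-nonneg (<⇒≤ 0<L) (0≤y-x 16η≤β))
            (solve 3 (λ β L η → con (+ 2) :* (β :* L :- con (+ 8) :* η :* L) := β :* L :+ L :* (β :- con (+ 16) :* η)) refl β L η) ⟩
        fromℕ 2 * (β * L - ζ)            ∎)

      4αL≤exp : fromℕ 4 * (α * L) ≤ exp (β * L - ζ)
      4αL≤exp = *-cancelˡ-≤ (fromℕ-pos 15) (begin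
        fromℕ 16 * (fromℕ 4 * (α * L))   ≈⟨ solve 2 (λ α L → con (+ 16) :* (con (+ 4) :* (α :* L)) := con (+ 64) :* α :* L) refl α L ⟩
        fromℕ 64 * α * L                 ≤⟨ *-monoʳ (<⇒≤ 0<L) 64α≤β²L ⟩
        β * β * L * L                    ≈⟨ solve 2 (λ β L → β :* β :* L :* L := β :* L :* (β :* L)) refl β L ⟩
        β * L * (β * L)                  ≈⟨ *-cong (sym 2y≈βL) (sym 2y≈βL) ⟩
        (y + y) * (y + y)                ≈⟨ solve 1 (λ y → (y :+ y) :* (y :+ y) := con (+ 4) :* (y :* y)) refl y ⟩
        fromℕ 4 * (y * y)                ≤⟨ *-monoˡ (fromℕ-nonneg 4) (x²≤4exp 0≤y) ⟩
        fromℕ 4 * (fromℕ 4 * exp y)      ≈⟨ solve 1 (λ e → con (+ 4) :* (con (+ 4) :* e) := con (+ 16) :* e) refl (exp y) ⟩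
        fromℕ 16 * exp y                 ≤⟨ *-monoˡ (fromℕ-nonneg 16) (exp-mono y≤βL-ζ) ⟩
        fromℕ 16 * exp (β * L - ζ)       ∎)

    -- As b ≥ bp > n^β, ln b ≥ βL and so ε ln b ≥ εβL = ζ + 1. The part ζ accounts for q, and the
    -- summand 1 pays for the factor 2 ≤ e.
    2b^[1-ε]≤bq : fromℕ 2 * fromℕ b ^ʳ (1# - ε) ≤ fromℕ b * q
    2b^[1-ε]≤bq = begin
      fromℕ 2 * exp ((1# - ε) * M)                   ≤⟨ *-mono (fromℕ-nonneg 2) (<⇒≤ (exp-pos _)) 2≤exp1 (exp-mono exponent≤) ⟩
      exp 1# * exp (M + (- ζ + - 1#))                ≈⟨ sym (exp-+ _ _) ⟩
      exp (1# + (M + (- ζ + - 1#)))                  ≈⟨ exp-cong (solve 2 (λ M z → con (+ 1) :+ (M :+ (:- z :+ :- con (+ 1))) := M :+ :- z) refl M ζ) ⟩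
      exp (M + - ζ)                                  ≈⟨ exp-+ _ _ ⟩
      exp M * q                                      ≈⟨ *-congʳ expM≈b ⟩
      fromℕ b * q                                    ∎
      where
      M = ln (fromℕ b)

      expM≈b : exp M ≈ fromℕ b
      expM≈b = exp-ln (≤-trans 1≤a a≤b′)

      βL≤M : β * L ≤ M
      βL≤M = exp-cancel-≤ (begin
        exp (β * L)       ≤⟨ <⇒≤ nᵝ<bp ⟩
        fromℕ b * p       ≤⟨ *-monoˡ (fromℕ-nonneg b) p≤1 ⟩
        fromℕ b * 1#      ≈⟨ trans (*-identityʳ _) (sym expM≈b) ⟩
        exp M             ∎)

      exponent≤ : (1# - ε) * M ≤ M + (- ζ + - 1#)
      exponent≤ = begin
        (1# - ε) * M                  ≈⟨ solve 2 (λ ε M → (con (+ 1) :- ε) :* M := M :+ :- (ε :* M)) refl ε M ⟩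
        M + - (ε * M)                 ≤⟨ +-monoˡ M (neg-mono (≤-trans (≤-reflexive (sym εβL≈8ηL+1)) (*-monoˡ 0≤ε βL≤M))) ⟩
        M + - (ζ + 1#)                ≈⟨ +-congˡ (solve 1 (λ z → :- (z :+ con (+ 1)) := :- z :+ :- con (+ 1)) refl ζ) ⟩
        M + (- ζ + - 1#)              ∎

    -- By 2 ≤ e the left side is at most exp (a + 1 - bq). After doubling the exponent, one copy of
    -- bq covers 4a ≥ 2(a + 1), using a ≥ 1, and the other covers twice `B`.
    failure≤ : fromℕ 2 * (fromℕ 2 ^ a * exp (fromℕ b * (- q))) ≤ exp (- (fromℕ b ^ʳ (1# - ε)))
    failure≤ = begin
      fromℕ 2 * (fromℕ 2 ^ a * exp (fromℕ b * (- q)))        ≈⟨ sym (*-assoc _ _ _) ⟩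
      fromℕ 2 ^ suc a * exp (fromℕ b * (- q))                ≤⟨ *-monoʳ (<⇒≤ (exp-pos _)) (^-mono (suc a) (fromℕ-nonneg 2) 2≤exp1) ⟩
      exp 1# ^ suc a * exp (fromℕ b * (- q))                 ≈⟨ *-congʳ (sym (exp-fromℕ-* (suc a) 1#)) ⟩
      exp (fromℕ (suc a) * 1#) * exp (fromℕ b * (- q))       ≈⟨ sym (exp-+ _ _) ⟩
      exp (fromℕ (suc a) * 1# + fromℕ b * (- q))             ≤⟨ exp-mono (*-cancelˡ-≤ (fromℕ-pos 1) exponent≤) ⟩
      exp (- B)                                              ∎
      where
      B = fromℕ b ^ʳ (1# - ε)

      exponent≤ : fromℕ 2 * (fromℕ (suc a) * 1# + fromℕ b * (- q)) ≤ fromℕ 2 * (- B)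
      exponent≤ = ≤-by
        (+-nonneg (+-nonneg (0≤y-x 4a≤bq) (0≤y-x 2b^[1-ε]≤bq)) (*-nonneg (fromℕ-nonneg 2) (0≤y-x 1≤a)))
        (solve 4 (λ a b q B → con (+ 2) :* (:- B) := con (+ 2) :* ((con (+ 1) :+ a) :* con (+ 1) :+ b :* (:- q)) :+
          ((b :* q :- con (+ 4) :* a) :+ (b :* q :- con (+ 2) :* B) :+ con (+ 2) :* (a :- con (+ 1)))) refl (fromℕ a) (fromℕ b) q B)

    ℙ-smallDominatingSet : 1# - exp (- (fromℕ b ^ʳ (1# - ε))) ≤ ℙ[_∣_] a b p (SmallDominatingSet a b p f) NoIsolatedVertex
    ℙ-smallDominatingSet = begin
      1# - δ                                      ≈⟨ sym (trans (*-congˡ (*-inverseʳ 0<PF)) (*-identityʳ _)) ⟩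
      (1# - δ) * (PF * PF ⁻¹)                     ≈⟨ sym (*-assoc _ _ _) ⟩
      (1# - δ) * PF * PF ⁻¹                       ≤⟨ *-monoʳ (<⇒≤ (⁻¹-pos 0<PF)) [1-δ]PF≤PEF ⟩
      PEF * PF ⁻¹                                 ∎
      where
      δ = exp (- (fromℕ b ^ʳ (1# - ε)))
      X = fromℕ 2 ^ a * exp (fromℕ b * (- q))
      PF = ℙ[_] a b p NoIsolatedVertex
      PEF = ℙ[_] a b p (SmallDominatingSet a b p f Unary.∩ NoIsolatedVertex)

      -- Positivity makes the division in the conditional probability a true one instead of a
      -- product with the default inverse 0.
      0<PF : 0# < PF
      0<PF = *-cancelˡ-0< (fromℕ-nonneg 2) (<-≤-trans 0<1 1/2≤ℙ-NoIsolatedVertex)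

      -- `failure≤` has a factor 2 to spare, and 1 ≤ 2 · `PF` turns the unconditional bound into a
      -- multiple of `PF`.
      X≤δPF : X ≤ δ * PF
      X≤δPF = *-cancelˡ-≤ (fromℕ-pos 1) (begin
        fromℕ 2 * X            ≤⟨ failure≤ ⟩
        δ                      ≈⟨ sym (*-identityʳ δ) ⟩
        δ * 1#                 ≤⟨ *-monoˡ (<⇒≤ (exp-pos _)) 1/2≤ℙ-NoIsolatedVertex ⟩
        δ * (fromℕ 2 * PF)     ≈⟨ solve 2 (λ d x → d :* (con (+ 2) :* x) := con (+ 2) :* (d :* x)) refl δ PF ⟩
        fromℕ 2 * (δ * PF)     ∎)

      PF≤PEF+X : PF ≤ PEF + X
      PF≤PEF+X = ℙ-failure p 0<p p≤1 ζ κ 0<κ 4κ≤1 8κ≤ζp 0≤ζ a b (SmallDominatingSet a b p f) smallDominatingSet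

      [1-δ]PF≤PEF : (1# - δ) * PF ≤ PEF
      [1-δ]PF≤PEF = ≤-by (+-nonneg (0≤y-x PF≤PEF+X) (0≤y-x X≤δPF))
        (solve 4 (λ d F E x → E := (con (+ 1) :- d) :* F :+ ((E :+ x :- F) :+ (d :* F :- x))) refl δ PF PEF X)

-- The choice of ε and the passage to large n

theorem1p2 : (em : ExcludedMiddle 0ℓ) (R : CompleteOrderedField) →
    let open RealAnalysis em R
        open RandomBipartiteGraph
    in
    (α β : ℝ) → 0# < α → 0# < β →
    (f : ℕ → ℝ) → f ⟶∞ →
    (a b : ℕ → ℕ) (p : ℕ → ℝ) →
    Eventually (λ n →
      (0# < p n) × (p n ≤ 1#) ×
      (ln (fromℕ n) ^ 2 ≤ fromℕ (a n)) × (a n ℕ.≤ b n) × (b n ℕ.≤ n) ×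
      (fromℕ (a n) * p n ≤ α * ln (fromℕ n)) ×
      (fromℕ n ^ʳ β < fromℕ (b n) * p n)) →
    ∃[ ε ] ((ε ⟶ 0#) ×
      Eventually (λ n →
        1# - exp (- (fromℕ (b n) ^ʳ (1# - ε n))) ≤
        ℙ[_∣_] (a n) (b n) (p n)
          (λ G → ∃[ D ] (Dominating G D × (fromℕ ∣ D ∣ ≤ f n / p n)))
          NoIsolatedVertex))
theorem1p2 em R α β 0<α 0<β f f⟶∞ a b p hyps = ε , ε⟶0 ,
    eventually-map₂
      (λ n (0<p , p≤1 , L²≤a , a≤b , b≤n , ap≤αL , nᵝ<bp)
           ((1≤f , 16η≤β , 4ηα≤1) , (1≤L , 64α≤β²L , 8≤β²L)) →
        let 0<f = <-≤-trans 0<1 1≤f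
            0<L = <-≤-trans 0<1 1≤L
            0<η = *-pos 0<36α (⁻¹-pos 0<f)
        in ℙ-smallDominatingSet 0<β 0<p p≤1 L²≤a a≤b b≤n ap≤αL nᵝ<bp
             1≤f (ηf≈36α n 0<f) 0<η 16η≤β 4ηα≤1 1≤L 64α≤β²L 8≤β²L
             (*-nonneg (+-nonneg (*-nonneg (fromℕ-nonneg 8) (<⇒≤ 0<η)) (<⇒≤ (⁻¹-pos 0<L))) (<⇒≤ (⁻¹-pos 0<β)))
             (εβL≈8ηL+1 n 0<L))
      hyps
      (eventually-map₂ (λ _ → _,_)
        (eventually-map₂ (λ _ → _,_) (f⟶∞ 1#)
          (eventually-map₂ (λ _ → _,_)
            (⟶0⇒eventually≤ (c*η⟶0 (fromℕ 16)) 0<β)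
            (⟶0⇒eventually≤ (⟶-respʳ-≈ (zeroʳ (fromℕ 4)) (⟶-* (⟶-const (fromℕ 4))
              (⟶-respʳ-≈ (zeroˡ α) (⟶-* η⟶0 (⟶-const α))))) 0<1)))
        (eventually-map₂ (λ _ → _,_) (ln-⟶∞ 1#)
          (eventually-map₂ (λ _ → _,_) (β²L⟶∞ (fromℕ 64 * α)) (β²L⟶∞ (fromℕ 8)))))
  where
  open RealAnalysis em R
  open OrderedField em R
  open Limits em R
  open Series em R
  open Domination em R

  L η ε : ℕ → ℝ
  L n = ln (fromℕ n)
  -- Where `f n` vanishes the inverse is the default 0; `η` is used only for `n` with 1 ≤ `f n`.
  η n = fromℕ 36 * α * f n ⁻¹
  -- The solution of εβL = 8ηL + 1; it tends to 0 because both η and 1/L do.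
  ε n = (fromℕ 8 * η n + L n ⁻¹) * β ⁻¹

  0<36α : 0# < fromℕ 36 * α
  0<36α = *-pos (fromℕ-pos 35) 0<α

  η⟶0 : η ⟶ 0#
  η⟶0 = ⟶-respʳ-≈ (zeroʳ (fromℕ 36 * α)) (⟶-* (⟶-const (fromℕ 36 * α)) (⟶∞⇒⁻¹⟶0 f⟶∞))

  c*η⟶0 : ∀ c → (λ n → c * η n) ⟶ 0#
  c*η⟶0 c = ⟶-respʳ-≈ (zeroʳ c) (⟶-* (⟶-const c) η⟶0)

  β²L⟶∞ : (λ n → β * β * L n) ⟶∞
  β²L⟶∞ = ⟶∞-*ˡ (*-pos 0<β 0<β) ln-⟶∞

  ε⟶0 : ε ⟶ 0#
  ε⟶0 = ⟶-respʳ-≈ (trans (*-congʳ (+-identityˡ 0#)) (zeroˡ (β ⁻¹)))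
    (⟶-* (⟶-+ (c*η⟶0 (fromℕ 8)) (⟶∞⇒⁻¹⟶0 ln-⟶∞)) (⟶-const (β ⁻¹)))

  ηf≈36α : ∀ n → 0# < f n → η n * f n ≈ fromℕ 36 * α
  ηf≈36α n 0<f = trans (*-assoc _ _ _) (trans (*-congˡ (trans (*-comm _ _) (*-inverseʳ 0<f))) (*-identityʳ _))

  εβL≈8ηL+1 : ∀ n → 0# < L n → ε n * (β * L n) ≈ fromℕ 8 * η n * L n + 1#
  εβL≈8ηL+1 n 0<L = begin-equality
    (fromℕ 8 * η n + L n ⁻¹) * β ⁻¹ * (β * L n)      ≈⟨ solve 5 (λ h i j β L → (h :+ i) :* j :* (β :* L) := (β :* j) :* (h :* L :+ L :* i)) refl
                                                          (fromℕ 8 * η n) (L n ⁻¹) (β ⁻¹) β (L n) ⟩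
    β * β ⁻¹ * (fromℕ 8 * η n * L n + L n * L n ⁻¹)  ≈⟨ *-cong (*-inverseʳ 0<β) (+-congˡ (*-inverseʳ 0<L)) ⟩
    1# * (fromℕ 8 * η n * L n + 1#)                  ≈⟨ *-identityˡ _ ⟩
    fromℕ 8 * η n * L n + 1#                         ∎
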